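{- Let $m,n$ be nonnegative integers with $p=2m+n\geq 2$, and let $\Delta\geq 5$. Let $\mathcal{G}'_\Delta$ be the family of simple graphs with maximum degree $\Delta$ and degeneracy $\Delta-1$. Then $\chi_{(m,n)}(\mathcal{G}'_\Delta)\leq 2(\Delta-1)^p p^{\Delta-1}$.
   Context: An $(m,n)$-colored mixed graph is a graph whose connections are either arcs, each colored with one of $m$ colors $\alpha_1,\dots,\alpha_m$, or edges, each colored with one of $n$ colors $\beta_1,\dots,\beta_n$, such that the underlying undirected graph (forgetting orientations and colors) is simple. A colored homomorphism of $G$ to $H$ is a vertex map sending each arc (resp. edge) of $G$ to an arc (resp. edge) of $H$ of the same color, preserving arc direction. For an $(m,n)$-colored mixed graph $G$, $\chi_{(m,n)}(G)$ is the minimum number of vertices of an $(m,n)$-colored mixed graph $H$ such that $G$ admits a colored homomorphism to $H$. For a simple undirected graph $G$, $\chi_{(m,n)}(G)$ is the maximum of $\chi_{(m,n)}(G')$ over all $(m,n)$-colored mixed graphs $G'$ with underlying graph $G$; for a family $\mathcal{F}$, $\chi_{(m,n)}(\mathcal{F})$ is the supremum over $G\in\mathcal{F}$. A graph is $d$-degenerate if every subgraph has a vertex of degree at most $d$; the degeneracy is the minimum such $d$. -}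

module Defs where

open import Data.Nat using (ℕ; zero; suc; _+_; _*_; _∸_; _^_; _≤_; _<_; _≥_)
open import Data.Bool using (Bool; true; false; _∧_; T)
open import Data.Fin using (Fin)
open import Data.List using (List; length; filter)
open import Data.List using (allFin)
open import Data.Product using (Σ; ∃; ∃-syntax; _×_; _,_)
open import Relation.Binary.PropositionalEquality using (_≡_; _≢_)
open import Relation.Nullary using (¬_)
open import Relation.Nullary.Decidable using (does)
open import Data.Bool.Properties using () renaming (_≟_ to _≟B_)

record SimpleGraph (k : ℕ) : Set where
  field
    adj   : Fin k → Fin k → Bool
    sym   : ∀ u v → adj u v ≡ adj v u
    irrefl : ∀ v → adj v v ≡ false
open SimpleGraph public

count : {k : ℕ} → (Fin k → Bool) → ℕ
count {k} P = length (filter (λ x → P x ≟B true) (allFin k))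

degree : {k : ℕ} → SimpleGraph k → Fin k → ℕ
degree G v = count (λ u → adj G u v)

MaxDegree : {k : ℕ} → SimpleGraph k → ℕ → Set
MaxDegree G Δ = (∀ v → degree G v ≤ Δ) × (∃[ v ] degree G v ≡ Δ)

record Subgraph {k : ℕ} (G : SimpleGraph k) : Set where
  field
    inS    : Fin k → Bool
    inF    : Fin k → Fin k → Bool
    F-sym  : ∀ u v → inF u v ≡ inF v u
    F-sub  : ∀ u v → inF u v ≡ true → (adj G u v ≡ true) × (inS u ≡ true) × (inS v ≡ true)
open Subgraph public

subDegree : {k : ℕ} {G : SimpleGraph k} → Subgraph G → Fin k → ℕ
subDegree H v = count (λ u → inF H u v)

Degenerate : {k : ℕ} → SimpleGraph k → ℕ → Set
Degenerate G d = (H : Subgraph G) → (∃[ v ] inS H v ≡ true) →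
                 ∃[ v ] (inS H v ≡ true) × (subDegree H v ≤ d)

Degeneracy : {k : ℕ} → SimpleGraph k → ℕ → Set
Degeneracy G d = Degenerate G d × (∀ e → e < d → ¬ Degenerate G e)

-- (m,n)-colored mixed graphs on Fin k.  conn u v records the connection
-- between u and v as seen from u: nothing, an arc u→v of color αᵢ,
-- an arc v→u of color αᵢ, or an edge of color βⱼ.

data Conn (m n : ℕ) : Set where
  none   : Conn m n
  arcOut : Fin m → Conn m n
  arcIn  : Fin m → Conn m n
  edge   : Fin n → Conn m n

flipC : {m n : ℕ} → Conn m n → Conn m n
flipC none       = none
flipC (arcOut i) = arcIn i
flipC (arcIn i)  = arcOut i
flipC (edge j)   = edge j

record MixedGraph (m n k : ℕ) : Set where
  field
    conn      : Fin k → Fin k → Conn m n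
    conn-flip : ∀ u v → conn v u ≡ flipC (conn u v)
    conn-loop : ∀ v → conn v v ≡ none
open MixedGraph public

isNone : {m n : ℕ} → Conn m n → Bool
isNone none = true
isNone _    = false

HasUnderlying : {m n k : ℕ} → MixedGraph m n k → SimpleGraph k → Set
HasUnderlying G' G = ∀ u v → (conn G' u v ≡ none → adj G u v ≡ false)
                            × (adj G u v ≡ false → conn G' u v ≡ none)

IsColoredHom : {m n k h : ℕ} → MixedGraph m n k → MixedGraph m n h → (Fin k → Fin h) → Set
IsColoredHom G H f = ∀ u v → conn G u v ≢ none → conn H (f u) (f v) ≡ conn G u v

ChiAtMost : {m n k : ℕ} → MixedGraph m n k → ℕ → Set
ChiAtMost {m} {n} G b = ∃[ h ] (h ≤ b) × Σ (MixedGraph m n h) (λ H → ∃[ f ] IsColoredHom G H f)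

{-# OPTIONS --safe #-}

-- Put p = 2m + n and t = Δ - 1.  The target H is built from a large set of labels with a
-- connection type σ i j for every pair, such that for any t labels j with prescribed types a
-- there are at least t labels i with σ i j = a throughout.  For a random σ the number of such i
-- is binomial with mean about 2 t ^ p, so Chernoff's bound and a union bound over all
-- prescriptions give existence; the random choice is derandomised by fixing the pairs one by
-- one without increasing the expected exponential weight.  Prescribing only t - u types leaves
-- more than (u + 1)(t - 1) labels, since an additional label splits the forbidden ones.
--
-- G is then coloured greedily along a degeneracy order, with the invariant that the coloured
-- neighbours of an uncoloured vertex have distinct labels.  A vertex with t - u coloured
-- neighbours has at most u + 1 uncoloured ones, each of which forbids at most t - 1 labels.
module Submission where

-- Expectations over the t entries that a demand reads are multiplied by `p ^ t`, so the
-- probabilistic argument stays inside the natural numbers. With c vertices per label and N * c = 2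
-- t^p p^t, a label serves a demand of t types with probability c / p^t, whence the mean 2 t^p. A
-- weight 1/λ for each serving label bounds the probability of fewer than t of them by roughly
-- λ^(t-1) exp(-(1 - 1/λ) 2 t^p), which is least at λ = 2 t^p / (t-1). For p = 2 and t = 4, the
-- smallest case and one with little room, this is 32/3; the weight ratio 8 is a nearby power of
-- two, so that it merges with the other powers of 2 in the estimates. Labels, rather than vertices,
-- are what the colouring keeps distinct: vertices that share a label are not joined, and two
-- neighbours with the same label could prescribe incompatible types for it.

open import Defs
open import Data.Nat using (ℕ; _+_; _*_; _∸_; _^_; _≤_; _≥_)
open import Data.Nat using (zero; suc; _<_; z≤n; s≤s; s≤s⁻¹; NonZero; >-nonZero; _!)
open import Data.Nat.Properties hiding (_≟_)
open import Data.Nat.ListAction using () renaming (sum to sumᴸ)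
open import Data.Nat.Solver using (module +-*-Solver)
open import Data.Bool using (Bool; true; false; if_then_else_; _∧_; not)
open import Data.Bool.Properties using (∧-zeroʳ; ∧-comm) renaming (_≟_ to _≟ᴮ_)
open import Data.Empty using (⊥)
open import Data.Fin using (Fin; zero; suc; punchIn; splitAt; _↑ˡ_; _↑ʳ_; combine; remQuot; fromℕ<; opposite)
open import Data.Fin.Properties as Fin using (_≟_; any?; pigeonhole; punchInᵢ≢i; splitAt-↑ˡ; splitAt-↑ʳ; splitAt⁻¹-↑ˡ; splitAt⁻¹-↑ʳ; remQuot-combine; opposite-involutive)
open import Data.List using (List; []; _∷_; _++_; map; filter; length; lookup; concatMap; allFin; cartesianProduct; cartesianProductWith)
open import Data.List.Properties using (≡-dec; length-map; length-++; length-tabulate; ∷-injective)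
open import Data.List.Membership.Propositional using (_∈_; _∉_)
open import Data.List.Membership.Propositional.Properties using (∈-length; ∈-allFin; ∈-++⁻; ∈-++⁺ˡ; ∈-++⁺ʳ; ∈-map⁺; ∈-map⁻; ∈-filter⁺; ∈-filter⁻; ∈-concatMap⁺; ∈-cartesianProduct⁺; ∈-cartesianProductWith⁺; ∈-cartesianProductWith⁻)
import Data.List.Membership.DecPropositional as DecMembership
open import Data.List.Relation.Unary.All as All using (All; []; _∷_)
open import Data.List.Relation.Unary.AllPairs using ([]; _∷_)
open import Data.List.Relation.Unary.Any as Any using (here; there; index)
open import Data.List.Relation.Unary.Any.Properties using (lookup-index)
open import Data.List.Relation.Unary.Unique.Propositional using (Unique)
open import Data.List.Relation.Unary.Unique.Propositional.Properties using (allFin⁺; filter⁺)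
open import Data.Maybe as Maybe using (Maybe; just; nothing; fromMaybe)
open import Data.Maybe.Properties using (just-injective)
open import Data.Product using (∃; ∃-syntax; _×_; _,_; proj₁; proj₂)
open import Data.Sum using (_⊎_; inj₁; inj₂; [_,_]′)
open import Data.Unit using (tt)
open import Data.Vec.Functional using (removeAt)
open import Function using (_∘_; id; _$_)
open import Relation.Binary.PropositionalEquality using (_≡_; _≢_; refl; trans; cong; cong₂; subst; subst₂; module ≡-Reasoning) renaming (sym to ≡-sym)
open import Relation.Nullary using (¬_; Dec; yes; no; contradiction; does)
open import Relation.Nullary.Decidable using (_×-dec_; ¬?)
open import Algebra.Properties.Semiring.Sum +-*-semiring using (sum; sum-cong-≗; sum-replicate-zero; sum-remove; ∑-distrib-+; ∑-comm; *-distribˡ-sum; *-distribʳ-sum)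
open import Algebra.Properties.CommutativeMonoid.Sum *-1-commutativeMonoid using () renaming (sum to prod; sum-cong-≗ to prod-cong; sum-remove to prod-remove)

-- Finite sums and products

x*y*z≡x*z*y : ∀ x y z → x * y * z ≡ x * z * y
x*y*z≡x*z*y = solve 3 (λ x y z → x :* y :* z := x :* z :* y) refl
  where open +-*-Solver

x*[y*z]≡y*[x*z] : ∀ x y z → x * (y * z) ≡ y * (x * z)
x*[y*z]≡y*[x*z] = solve 3 (λ x y z → x :* (y :* z) := y :* (x :* z)) refl
  where open +-*-Solver

sum-const : ∀ n c → sum {n} (λ _ → c) ≡ n * c
sum-const zero    c = refl
sum-const (suc n) c = cong (c +_) (sum-const n c)

prod-const : ∀ n c → prod {n} (λ _ → c) ≡ c ^ n
prod-const zero    c = refl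
prod-const (suc n) c = cong (c *_) (prod-const n c)

prod-mono : ∀ {n} {f g : Fin n → ℕ} → (∀ i → f i ≤ g i) → prod f ≤ prod g
prod-mono {zero}  f≤g = ≤-refl
prod-mono {suc n} f≤g = *-mono-≤ (f≤g zero) (prod-mono (f≤g ∘ suc))

sum-single : ∀ {n} (f : Fin n → ℕ) j → (∀ i → i ≢ j → f i ≡ 0) → sum f ≡ f j
sum-single {suc n} f j vanish = begin
  sum f                     ≡⟨ sum-remove {i = j} f ⟩
  f j + sum (removeAt f j)  ≡⟨ cong (f j +_) (sum-cong-≗ λ i → vanish (punchIn j i) punchInᵢ≢i′) ⟩
  f j + sum {n} (λ _ → 0)   ≡⟨ cong (f j +_) (sum-replicate-zero n) ⟩
  f j + 0                   ≡⟨ +-identityʳ (f j) ⟩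
  f j                       ∎
  where
  open ≡-Reasoning
  punchInᵢ≢i′ : ∀ {i} → punchIn j i ≢ j
  punchInᵢ≢i′ {i} eq = punchInᵢ≢i j i eq

≤-average : ∀ n (f : Fin (suc n) → ℕ) x → sum f ≤ suc n * x → ∃[ v ] f v ≤ x
≤-average zero    f x Σ≤ = zero , subst (f zero ≤_) (+-identityʳ x) (≤-trans (m≤m+n _ _) Σ≤)
≤-average (suc n) f x Σ≤ with f zero ≤? x
... | yes f₀≤x = zero , f₀≤x
... | no  f₀≰x with ≤-average n (f ∘ suc) x
                      (+-cancelˡ-≤ x _ _ (≤-trans (+-monoˡ-≤ _ (<⇒≤ (≰⇒> f₀≰x))) Σ≤))
...   | v , fv≤x = suc v , fv≤x

-- Independence of the factors: `v` influences only the one at `j`, so the rest comes out of the sum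
-- and averaging that single factor suffices.
prod-average : ∀ {p n} (f : Fin p → Fin n → ℕ) (g : Fin n → ℕ) j →
               (∀ v i → i ≢ j → f v i ≡ g i) → sum (λ v → f v j) ≡ p * g j →
               sum (λ v → prod (f v)) ≡ p * prod g
prod-average {p} {suc n} f g j same avg = begin
  sum (λ v → prod (f v))            ≡⟨ sum-cong-≗ split ⟩
  sum (λ v → f v j * rest)          ≡⟨ *-distribʳ-sum rest (λ v → f v j) ⟨
  sum (λ v → f v j) * rest          ≡⟨ cong (_* rest) avg ⟩
  p * g j * rest                    ≡⟨ *-assoc p (g j) rest ⟩
  p * (g j * rest)                  ≡⟨ cong (p *_) (prod-remove {i = j} g) ⟨
  p * prod g                        ∎
  where
  open ≡-Reasoning
  rest = prod (removeAt g j)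
  split : ∀ v → prod (f v) ≡ f v j * rest
  split v = trans (prod-remove {i = j} (f v))
    (cong (f v j *_) (prod-cong λ i → same v (punchIn j i) (punchInᵢ≢i j i)))

prod-exchange : ∀ {n} (f g : Fin n → ℕ) j x y → (∀ i → i ≢ j → f i ≡ g i) →
                f j * x ≤ g j * y → prod f * x ≤ prod g * y
prod-exchange {suc n} f g j x y same le = begin
  prod f * x                     ≡⟨ cong (_* x) (prod-remove {i = j} f) ⟩
  f j * prod (removeAt f j) * x  ≡⟨ cong (λ r → f j * r * x) (prod-cong λ i → same (punchIn j i) (punchInᵢ≢i j i)) ⟩
  f j * rest * x                 ≡⟨ x*y*z≡x*z*y (f j) rest x ⟩
  f j * x * rest                 ≤⟨ *-monoˡ-≤ rest le ⟩
  g j * y * rest                 ≡⟨ x*y*z≡x*z*y (g j) rest y ⟨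
  g j * rest * y                 ≡⟨ cong (_* y) (prod-remove {i = j} g) ⟨
  prod g * y                     ∎
  where
  open ≤-Reasoning
  rest = prod (removeAt g j)

override : ∀ {ℓ} {n} {B : Set ℓ} → (Fin n → B) → Fin n → B → Fin n → B
override f j b i = if does (i ≟ j) then b else f i

override-here : ∀ {ℓ n} {B : Set ℓ} (f : Fin n → B) j b → override f j b j ≡ b
override-here f j b with j ≟ j
... | yes _   = refl
... | no  j≢j = contradiction refl j≢j

override-there : ∀ {ℓ n} {B : Set ℓ} (f : Fin n → B) j b {i} → i ≢ j → override f j b i ≡ f i
override-there f j b {i} i≢j with i ≟ j
... | yes i≡j = contradiction i≡j i≢j
... | no  _   = refl

-- Each entry of `F` costs at most one factor `L`. The induction pays it at once: the value at the
-- head of `F` is multiplied by `L`, after which `j` is no longer exceptional. A repeated entry only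
-- weakens the bound.
prod-lower : ∀ {n} C L .{{_ : NonZero L}} F (f : Fin n → ℕ) → (∀ i → C ≤ f i * L) → (∀ i → i ∉ F → C ≤ f i) →
             C ^ n ≤ prod f * L ^ length F
prod-lower {n} C L [] f _ outside = begin
  C ^ n              ≡⟨ prod-const n C ⟨
  prod {n} (λ _ → C) ≤⟨ prod-mono (λ i → outside i λ ()) ⟩
  prod f             ≡⟨ *-identityʳ _ ⟨
  prod f * 1         ∎
  where open ≤-Reasoning
prod-lower {n} C L (j ∷ F) f all outside = begin
  C ^ n                         ≤⟨ prod-lower C L F f′ all′ outside′ ⟩
  prod f′ * L ^ length F        ≤⟨ *-monoˡ-≤ (L ^ length F) step ⟩
  prod f * L * L ^ length F     ≡⟨ *-assoc (prod f) L _ ⟩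
  prod f * (L * L ^ length F)   ∎
  where
  open ≤-Reasoning
  f′ = override f j (f j * L)
  f′-here = override-here f j (f j * L)
  step : prod f′ ≤ prod f * L
  step = subst (_≤ prod f * L) (*-identityʳ _) (prod-exchange f′ f j 1 L (λ i → override-there f j _)
           (≤-reflexive (trans (*-identityʳ _) f′-here)))
  outside′ : ∀ i → i ∉ F → C ≤ f′ i
  outside′ i i∉F with i ≟ j
  ... | yes refl = all j
  ... | no  i≢j  = outside i λ { (here eq) → i≢j eq ; (there i∈F) → i∉F i∈F }
  all′ : ∀ i → C ≤ f′ i * L
  all′ i with i ≟ j
  ... | yes _ = ≤-trans (all j) (m≤m*n (f j * L) L)
  ... | no  _ = all i

-- Lowering the value at the head of `F` to `w` costs at most the ratio `C / w`, written here
-- without division.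
prod-upper : ∀ {n} C w F (f : Fin n → ℕ) → w ≤ C → (∀ i → f i ≤ C) → (∀ i → i ∉ F → f i ≤ w) →
             prod f * w ^ length F ≤ w ^ n * C ^ length F
prod-upper {n} C w [] f _ _ outside =
  *-monoˡ-≤ 1 (subst (prod f ≤_) (prod-const n w) (prod-mono λ i → outside i λ ()))
prod-upper {n} C w (j ∷ F) f w≤C all outside = begin
  prod f * (w * w ^ length F)   ≡⟨ *-assoc (prod f) w _ ⟨
  prod f * w * w ^ length F     ≤⟨ *-monoˡ-≤ (w ^ length F) step ⟩
  prod f′ * C * w ^ length F    ≡⟨ x*y*z≡x*z*y (prod f′) C (w ^ length F) ⟩
  prod f′ * w ^ length F * C    ≤⟨ *-monoˡ-≤ C (prod-upper C w F f′ w≤C all′ outside′) ⟩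
  w ^ n * C ^ length F * C      ≡⟨ trans (*-assoc (w ^ n) _ C) (cong (w ^ n *_) (*-comm (C ^ length F) C)) ⟩
  w ^ n * (C * C ^ length F)    ∎
  where
  open ≤-Reasoning
  f′ = override f j w
  step : prod f * w ≤ prod f′ * C
  step = prod-exchange f f′ j w C (λ i i≢j → ≡-sym (override-there f j w i≢j))
    (subst (λ z → f j * w ≤ z * C) (≡-sym (override-here f j w)) (≤-trans (≤-reflexive (*-comm (f j) w)) (*-monoʳ-≤ w (all j))))
  outside′ : ∀ i → i ∉ F → f′ i ≤ w
  outside′ i i∉F with i ≟ j
  ... | yes refl = ≤-refl
  ... | no  i≢j  = outside i λ { (here eq) → i≢j eq ; (there i∈F) → i∉F i∈F }
  all′ : ∀ i → f′ i ≤ C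
  all′ i with i ≟ j
  ... | yes _ = w≤C
  ... | no  _ = all i

sum-list-exchange : ∀ {p} {B : Set} (f : Fin p → B → ℕ) ks →
  sum (λ v → sumᴸ (map (f v) ks)) ≡ sumᴸ (map (λ k → sum (λ v → f v k)) ks)
sum-list-exchange {p} f []       = sum-replicate-zero p
sum-list-exchange {p} f (k ∷ ks) =
  trans (∑-distrib-+ (λ v → f v k) _) (cong (sum (λ v → f v k) +_) (sum-list-exchange f ks))

-- Derandomised selection of a matrix of types

module _ {p : ℕ} where

  private
    A = Fin p

  -- p times the probability that a (partially known) uniform element of A is b.
  charge : Maybe A → A → ℕ
  charge nothing  b = 1
  charge (just a) b = if does (a ≟ b) then p else 0

  charge-hit : ∀ b → charge (just b) b ≡ p
  charge-hit b with b ≟ b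
  ... | yes _   = refl
  ... | no  b≢b = contradiction refl b≢b

  charge-miss : ∀ {a b} → a ≢ b → charge (just a) b ≡ 0
  charge-miss {a} {b} a≢b with a ≟ b
  ... | yes a≡b = contradiction a≡b a≢b
  ... | no  _   = refl

  -- An involution takes the value `b` exactly once, at `h b`; so a uniform `v` yields a uniform
  -- `h v`.
  sum-charge : (h : A → A) → (∀ a → h (h a) ≡ a) → ∀ b → sum (λ v → charge (just (h v)) b) ≡ p
  sum-charge h h-inv b = begin
    sum (λ v → charge (just (h v)) b)  ≡⟨ sum-single _ (h b) (λ v v≢hb → charge-miss λ hv≡b → v≢hb (trans (≡-sym (h-inv v)) (cong h hv≡b))) ⟩
    charge (just (h (h b))) b          ≡⟨ cong (λ a → charge (just a) b) (h-inv b) ⟩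
    charge (just b) b                  ≡⟨ charge-hit b ⟩
    p                                  ∎
    where open ≡-Reasoning

  total : ℕ → (List A → ℕ) → ℕ
  total zero    κ = κ []
  total (suc s) κ = sum λ b → total s (κ ∘ (b ∷_))

  module _ {Label : Set} where

    -- p ^ length js times the expected value of κ on the entries of a partially known row at js.
    weigh : (Label → Maybe A) → List Label → (List A → ℕ) → ℕ
    weigh r []       κ = κ []
    weigh r (j ∷ js) κ = sum λ b → charge (r j) b * weigh r js (κ ∘ (b ∷_))

    weigh-cong : ∀ {r r′} js κ → (∀ {j} → j ∈ js → r j ≡ r′ j) → weigh r js κ ≡ weigh r′ js κ
    weigh-cong []       κ eq = refl
    weigh-cong (j ∷ js) κ eq = sum-cong-≗ λ b →
      cong₂ _*_ (cong (λ m → charge m b) (eq (here refl))) (weigh-cong js (κ ∘ (b ∷_)) (eq ∘ there))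

    weigh-blank : ∀ js κ → weigh (λ _ → nothing) js κ ≡ total (length js) κ
    weigh-blank []       κ = refl
    weigh-blank (j ∷ js) κ = sum-cong-≗ λ b → trans (*-identityˡ _) (weigh-blank js (κ ∘ (b ∷_)))

    weigh-known : ∀ r (σ : Label → A) js κ → (∀ {j} → j ∈ js → r j ≡ just (σ j)) →
                  weigh r js κ ≡ p ^ length js * κ (map σ js)
    weigh-known r σ []       κ known = ≡-sym (*-identityˡ _)
    weigh-known r σ (j ∷ js) κ known = begin
      sum (λ b → charge (r j) b * weigh r js (κ ∘ (b ∷_)))
        ≡⟨ sum-cong-≗ (λ b → cong (λ m → charge m b * weigh r js (κ ∘ (b ∷_))) (known (here refl))) ⟩
      sum (λ b → charge (just (σ j)) b * weigh r js (κ ∘ (b ∷_)))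
        ≡⟨ sum-single _ (σ j) (λ b b≢ → cong (_* weigh r js (κ ∘ (b ∷_))) (charge-miss (b≢ ∘ ≡-sym))) ⟩
      charge (just (σ j)) (σ j) * weigh r js (κ ∘ (σ j ∷_))
        ≡⟨ cong₂ _*_ (charge-hit (σ j)) (weigh-known r σ js _ (known ∘ there)) ⟩
      p * (p ^ length js * κ (map σ (j ∷ js)))
        ≡⟨ *-assoc p _ _ ⟨
      p * p ^ length js * κ (map σ (j ∷ js)) ∎
      where open ≡-Reasoning

    -- Uniqueness of `js` lets the entry at `j` be read only once, so the weight is linear in its
    -- charge. At the head `sum-charge` averages the charges to `p`; further down the sum over `v`
    -- passes through the outer charge. The two uses take `h = id` for the row of one endpoint of a
    -- pair and `h = fl` for the row of the other.
    weigh-average : ∀ r (r′ : A → Label → Maybe A) (h : A → A) → (∀ a → h (h a) ≡ a) → ∀ j →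
                    r j ≡ nothing → (∀ v → r′ v j ≡ just (h v)) → (∀ v {i} → i ≢ j → r′ v i ≡ r i) →
                    ∀ {js} → Unique js → j ∈ js → ∀ κ → sum (λ v → weigh (r′ v) js κ) ≡ p * weigh r js κ
    weigh-average r r′ h h-inv j open′ fixed same {_ ∷ js} (j∉js ∷ _) (here refl) κ = begin
      sum (λ v → sum (λ b → charge (r′ v j) b * weigh (r′ v) js (κ ∘ (b ∷_))))
        ≡⟨ sum-cong-≗ (λ v → sum-cong-≗ λ b → cong₂ _*_ (cong (λ m → charge m b) (fixed v))
             (weigh-cong js _ λ i∈js → same v (All.lookup j∉js i∈js ∘ ≡-sym))) ⟩
      sum (λ v → sum (λ b → charge (just (h v)) b * Y b))
        ≡⟨ ∑-comm (λ v b → charge (just (h v)) b * Y b) ⟩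
      sum (λ b → sum (λ v → charge (just (h v)) b * Y b))
        ≡⟨ sum-cong-≗ (λ b → *-distribʳ-sum (Y b) (λ v → charge (just (h v)) b)) ⟨
      sum (λ b → sum (λ v → charge (just (h v)) b) * Y b)
        ≡⟨ sum-cong-≗ (λ b → cong₂ _*_ (sum-charge h h-inv b) (≡-sym (*-identityˡ (Y b)))) ⟩
      sum (λ b → p * (1 * Y b))
        ≡⟨ *-distribˡ-sum p (λ b → 1 * Y b) ⟨
      p * sum (λ b → charge nothing b * Y b)
        ≡⟨ cong (λ m → p * sum (λ b → charge m b * Y b)) open′ ⟨
      p * weigh r (j ∷ js) κ ∎
      where
      open ≡-Reasoning
      Y : A → ℕ
      Y b = weigh r js (κ ∘ (b ∷_))
    weigh-average r r′ h h-inv j open′ fixed same {i ∷ js} (i∉js ∷ js!) (there j∈js) κ = begin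
      sum (λ v → sum (λ b → charge (r′ v i) b * weigh (r′ v) js (κ ∘ (b ∷_))))
        ≡⟨ sum-cong-≗ (λ v → sum-cong-≗ λ b → cong (λ m → charge m b * weigh (r′ v) js (κ ∘ (b ∷_)))
             (same v (All.lookup i∉js j∈js))) ⟩
      sum (λ v → sum (λ b → charge (r i) b * weigh (r′ v) js (κ ∘ (b ∷_))))
        ≡⟨ ∑-comm (λ v b → charge (r i) b * weigh (r′ v) js (κ ∘ (b ∷_))) ⟩
      sum (λ b → sum (λ v → charge (r i) b * weigh (r′ v) js (κ ∘ (b ∷_))))
        ≡⟨ sum-cong-≗ (λ b → *-distribˡ-sum (charge (r i) b) (λ v → weigh (r′ v) js (κ ∘ (b ∷_)))) ⟨
      sum (λ b → charge (r i) b * sum (λ v → weigh (r′ v) js (κ ∘ (b ∷_))))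
        ≡⟨ sum-cong-≗ (λ b → cong (charge (r i) b *_)
             (weigh-average r r′ h h-inv j open′ fixed same js! j∈js (κ ∘ (b ∷_)))) ⟩
      sum (λ b → charge (r i) b * (p * weigh r js (κ ∘ (b ∷_))))
        ≡⟨ sum-cong-≗ (λ b → x*[y*z]≡y*[x*z] (charge (r i) b) p _) ⟩
      sum (λ b → p * (charge (r i) b * weigh r js (κ ∘ (b ∷_))))
        ≡⟨ *-distribˡ-sum p (λ b → charge (r i) b * weigh r js (κ ∘ (b ∷_))) ⟨
      p * weigh r (i ∷ js) κ ∎
      where open ≡-Reasoning

module Selection {p′ : ℕ} (fl : Fin (suc p′) → Fin (suc p′)) (fl-inv : ∀ a → fl (fl a) ≡ a) (N C : ℕ) where

  private
    p = suc p′
    A = Fin p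
    Label = Fin N

  open DecMembership (_≟_ {n = N}) using (_∈?_)

  Test : Set
  Test = List Label × (List A → ℕ)

  State : Set
  State = Label → Label → Maybe A

  -- A label in `js` cannot serve its own demand and is given the weight of a failure. This also
  -- leaves unread the diagonal of the matrix and every entry with both ends in `js`.
  factor : State → Test → Label → ℕ
  factor ρ (js , κ) i = if does (i ∈? js) then C else weigh (ρ i) js κ

  factor-in : ∀ {ρ js κ i} → i ∈ js → factor ρ (js , κ) i ≡ C
  factor-in {js = js} {i = i} i∈js with i ∈? js
  ... | yes _    = refl
  ... | no  i∉js = contradiction i∈js i∉js

  factor-out : ∀ {ρ js κ i} → i ∉ js → factor ρ (js , κ) i ≡ weigh (ρ i) js κ
  factor-out {js = js} {i = i} i∉js with i ∈? js
  ... | yes i∈js = contradiction i∈js i∉js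
  ... | no  _    = refl

  factor-cong : ∀ ρ ρ′ js κ i → (i ∉ js → ∀ {j} → j ∈ js → ρ i j ≡ ρ′ i j) →
                factor ρ (js , κ) i ≡ factor ρ′ (js , κ) i
  factor-cong ρ ρ′ js κ i eq with i ∈? js
  ... | yes _    = refl
  ... | no  i∉js = weigh-cong js κ (eq i∉js)

  cost : State → Test → ℕ
  cost ρ k = prod (factor ρ k)

  potential : List Test → State → ℕ
  potential ks ρ = sumᴸ (map (cost ρ) ks)

  assign : State → Label → Label → A → State
  assign ρ a b v = override (override ρ a (override (ρ a) b (just v))) b (override (ρ b) a (just (fl v)))

  module _ (ρ : State) {a b : Label} (a≢b : a ≢ b) where

    private
      ρₐ : A → State
      ρₐ v = override ρ a (override (ρ a) b (just v))

    assign-a : ∀ v → assign ρ a b v a ≡ override (ρ a) b (just v)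
    assign-a v = trans (override-there (ρₐ v) b _ a≢b) (override-here ρ a _)

    assign-b : ∀ v → assign ρ a b v b ≡ override (ρ b) a (just (fl v))
    assign-b v = override-here (ρₐ v) b _

    assign-other : ∀ v {i} → i ≢ a → i ≢ b → assign ρ a b v i ≡ ρ i
    assign-other v i≢a i≢b = trans (override-there (ρₐ v) b _ i≢b) (override-there ρ a _ i≢a)

    assign-ab : ∀ v → assign ρ a b v a b ≡ just v
    assign-ab v = trans (cong (_$ b) (assign-a v)) (override-here (ρ a) b _)

    assign-ba : ∀ v → assign ρ a b v b a ≡ just (fl v)
    assign-ba v = trans (cong (_$ a) (assign-b v)) (override-here (ρ b) a _)

    assign-a≢ : ∀ v {j} → j ≢ b → assign ρ a b v a j ≡ ρ a j
    assign-a≢ v j≢b = trans (cong (_$ _) (assign-a v)) (override-there (ρ a) b _ j≢b)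

    assign-b≢ : ∀ v {j} → j ≢ a → assign ρ a b v b j ≡ ρ b j
    assign-b≢ v j≢a = trans (cong (_$ _) (assign-b v)) (override-there (ρ b) a _ j≢a)

    -- At most one factor reads the pair {a , b}: that of whichever endpoint lies outside js
    -- while the other lies inside.
    cost-average : ρ a b ≡ nothing → ρ b a ≡ nothing → ∀ {js} κ → Unique js →
                   sum (λ v → cost (assign ρ a b v) (js , κ)) ≡ p * cost ρ (js , κ)
    cost-average ρab ρba {js} κ js! with a ∈? js | b ∈? js
    ... | yes a∈js | b∈?js = prod-average _ _ b same (avg b∈?js)
      where
      same : ∀ v i → i ≢ b → factor (assign ρ a b v) (js , κ) i ≡ factor ρ (js , κ) i
      same v i i≢b = factor-cong (assign ρ a b v) ρ js κ i λ i∉js _ →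
        cong (_$ _) (assign-other v (λ { refl → i∉js a∈js }) i≢b)
      avg : Dec (b ∈ js) → sum (λ v → factor (assign ρ a b v) (js , κ) b) ≡ p * factor ρ (js , κ) b
      avg (yes b∈js) = trans (sum-cong-≗ λ v → factor-in {assign ρ a b v} {κ = κ} b∈js)
        (trans (sum-const p C) (cong (p *_) (≡-sym (factor-in {ρ} {κ = κ} b∈js))))
      avg (no  b∉js) = trans (sum-cong-≗ λ v → factor-out {assign ρ a b v} {κ = κ} b∉js)
        (trans (weigh-average (ρ b) (λ v → assign ρ a b v b) fl fl-inv a ρba assign-ba assign-b≢ js! a∈js κ)
          (cong (p *_) (≡-sym (factor-out {ρ} {κ = κ} b∉js))))
    ... | no a∉js | b∈?js = prod-average _ _ a same (avg b∈?js)
      where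
      same : ∀ v i → i ≢ a → factor (assign ρ a b v) (js , κ) i ≡ factor ρ (js , κ) i
      same v i i≢a = factor-cong (assign ρ a b v) ρ js κ i λ i∉js {j} j∈js → row (i ≟ b) λ { refl → a∉js j∈js }
        where
        row : ∀ {j} → Dec (i ≡ b) → j ≢ a → assign ρ a b v i j ≡ ρ i j
        row (yes refl) j≢a = assign-b≢ v j≢a
        row (no  i≢b)  _   = cong (_$ _) (assign-other v i≢a i≢b)
      avg : Dec (b ∈ js) → sum (λ v → factor (assign ρ a b v) (js , κ) a) ≡ p * factor ρ (js , κ) a
      avg (yes b∈js) = trans (sum-cong-≗ λ v → factor-out {assign ρ a b v} {κ = κ} a∉js)
        (trans (weigh-average (ρ a) (λ v → assign ρ a b v a) id (λ _ → refl) b ρab assign-ab assign-a≢ js! b∈js κ)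
          (cong (p *_) (≡-sym (factor-out {ρ} {κ = κ} a∉js))))
      avg (no  b∉js) = trans (sum-cong-≗ λ v → factor-cong (assign ρ a b v) ρ js κ a λ _ j∈js → assign-a≢ v λ { refl → b∉js j∈js })
        (sum-const p _)

    potential-average : ρ a b ≡ nothing → ρ b a ≡ nothing → ∀ {ks} → All (Unique ∘ proj₁) ks →
                        sum (λ v → potential ks (assign ρ a b v)) ≡ p * potential ks ρ
    potential-average ρab ρba {ks} uniq = trans (sum-list-exchange (λ v → cost (assign ρ a b v)) ks) (go uniq)
      where
      go : ∀ {ks} → All (Unique ∘ proj₁) ks →
           sumᴸ (map (λ k → sum (λ v → cost (assign ρ a b v) k)) ks) ≡ p * potential ks ρ
      go []                       = ≡-sym (*-zeroʳ p)
      go (_∷_ {js , κ} js! ks!) = trans (cong₂ _+_ (cost-average ρab ρba κ js!) (go ks!))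
        (≡-sym (*-distribˡ-+ p (cost ρ (js , κ)) _))

  -- `Maybe.map` extends the symmetry to open entries: an entry is open exactly when its mirror is,
  -- so a pair can always be fixed as a whole.
  Coherent : State → Set
  Coherent ρ = ∀ {i j} → i ≢ j → ρ j i ≡ Maybe.map fl (ρ i j)

  assign-coherent : ∀ {ρ a b} → a ≢ b → Coherent ρ → ∀ v → Coherent (assign ρ a b v)
  assign-coherent {ρ} {a} {b} a≢b coh v i≢j = go (_ ≟ a) (_ ≟ b) (_ ≟ a) (_ ≟ b) i≢j
    where
    go : ∀ {i j} → Dec (i ≡ a) → Dec (i ≡ b) → Dec (j ≡ a) → Dec (j ≡ b) → i ≢ j →
         assign ρ a b v j i ≡ Maybe.map fl (assign ρ a b v i j)
    go (yes refl) (yes refl) _ _ i≢j = contradiction refl a≢b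
    go (yes refl) _ (yes refl) _ i≢j = contradiction refl i≢j
    go _ (yes refl) _ (yes refl) i≢j = contradiction refl i≢j
    go _ _ (yes refl) (yes refl) i≢j = contradiction refl a≢b
    go (yes refl) (no _) (no _) (yes refl) i≢j = trans (assign-ba ρ a≢b v) (cong (Maybe.map fl) (≡-sym (assign-ab ρ a≢b v)))
    go (no _) (yes refl) (yes refl) (no _) i≢j = trans (assign-ab ρ a≢b v)
      (trans (cong just (≡-sym (fl-inv v))) (cong (Maybe.map fl) (≡-sym (assign-ba ρ a≢b v))))
    go (yes refl) (no _) (no j≢a) (no j≢b) i≢j = trans (cong (_$ _) (assign-other ρ a≢b v j≢a j≢b))
      (trans (coh i≢j) (cong (Maybe.map fl) (≡-sym (assign-a≢ ρ a≢b v j≢b))))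
    go (no _) (yes refl) (no j≢a) (no j≢b) i≢j = trans (cong (_$ _) (assign-other ρ a≢b v j≢a j≢b))
      (trans (coh i≢j) (cong (Maybe.map fl) (≡-sym (assign-b≢ ρ a≢b v j≢a))))
    go (no i≢a) (no i≢b) (yes refl) (no _) i≢j = trans (assign-a≢ ρ a≢b v i≢b)
      (trans (coh i≢j) (cong (Maybe.map fl) (cong (_$ _) (≡-sym (assign-other ρ a≢b v i≢a i≢b)))))
    go (no i≢a) (no i≢b) (no _) (yes refl) i≢j = trans (assign-b≢ ρ a≢b v i≢a)
      (trans (coh i≢j) (cong (Maybe.map fl) (cong (_$ _) (≡-sym (assign-other ρ a≢b v i≢a i≢b)))))
    go (no i≢a) (no i≢b) (no j≢a) (no j≢b) i≢j = trans (cong (_$ _) (assign-other ρ a≢b v j≢a j≢b))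
      (trans (coh i≢j) (cong (Maybe.map fl) (cong (_$ _) (≡-sym (assign-other ρ a≢b v i≢a i≢b)))))

  Known : State → Label → Label → Set
  Known ρ i j = ∃[ v ] ρ i j ≡ just v

  assign-known : ∀ {ρ a b} → a ≢ b → ∀ v {i j} → Known ρ i j → Known (assign ρ a b v) i j
  assign-known {ρ} {a} {b} a≢b v = go (_ ≟ a) (_ ≟ b) (_ ≟ a) (_ ≟ b)
    where
    go : ∀ {i j} → Dec (i ≡ a) → Dec (i ≡ b) → Dec (j ≡ a) → Dec (j ≡ b) → Known ρ i j → Known (assign ρ a b v) i j
    go (yes refl) _ _ (yes refl) (u , eq) = v , assign-ab ρ a≢b v
    go _ (yes refl) (yes refl) _ (u , eq) = fl v , assign-ba ρ a≢b v
    go (yes refl) _ _ (no j≢b) (u , eq) = u , trans (assign-a≢ ρ a≢b v j≢b) eq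
    go (no _) (yes refl) (no j≢a) _ (u , eq) = u , trans (assign-b≢ ρ a≢b v j≢a) eq
    go (no i≢a) (no i≢b) _ _ (u , eq) = u , trans (cong (_$ _) (assign-other ρ a≢b v i≢a i≢b)) eq

  module _ (ks : List Test) (ks! : All (Unique ∘ proj₁) ks) where

    fill : ∀ ps ρ → Coherent ρ → ∃[ ρ′ ] Coherent ρ′ × potential ks ρ′ ≤ potential ks ρ ×
           (∀ {i j} → Known ρ i j → Known ρ′ i j) × (∀ {i j} → (i , j) ∈ ps → i ≢ j → Known ρ′ i j)
    fill []             ρ coh = ρ , coh , ≤-refl , id , λ ()
    fill ((a , b) ∷ ps) ρ coh with a ≟ b | ρ a b in ρab
    ... | yes a≡b | _ with fill ps ρ coh
    ...   | ρ′ , coh′ , le , mono , known = ρ′ , coh′ , le , mono ,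
            λ { (here refl) a≢b → contradiction a≡b a≢b ; (there ij∈ps) → known ij∈ps }
    -- The list holds both orders of each pair, and `assign` settles both at the first meeting.
    fill ((a , b) ∷ ps) ρ coh | no _ | just v with fill ps ρ coh
    ...   | ρ′ , coh′ , le , mono , known = ρ′ , coh′ , le , mono ,
            λ { (here refl) _ → mono (v , ρab) ; (there ij∈ps) → known ij∈ps }
    fill ((a , b) ∷ ps) ρ coh | no a≢b | nothing
      with ≤-average p′ _ (potential ks ρ) (≤-reflexive
             (potential-average ρ a≢b ρab (trans (coh a≢b) (cong (Maybe.map fl) ρab)) ks!))
    ... | v , le₁ with fill ps (assign ρ a b v) (assign-coherent {ρ} a≢b coh v)
    ...   | ρ′ , coh′ , le , mono , known = ρ′ , coh′ , ≤-trans le le₁ , mono ∘ assign-known {ρ} a≢b v ,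
            λ { (here refl) _ → mono (v , assign-ab ρ a≢b v) ; (there ij∈ps) → known ij∈ps }

    select : ∃[ σ ] (∀ {i j} → i ≢ j → σ j i ≡ fl (σ i j)) ×
             potential ks (λ i j → just (σ i j)) ≤ potential ks (λ _ _ → nothing)
    select with fill (cartesianProduct (allFin N) (allFin N)) (λ _ _ → nothing) (λ _ → refl)
    ... | ρ , coh , le , _ , known = σ , σ-coh , ≤-trans (≤-reflexive (go ks)) le
      where
      σ : Label → Label → A
      -- The default is reached only on the diagonal, which no factor reads.
      σ i j = fromMaybe zero (ρ i j)
      ρ≡σ : ∀ {i j} → i ≢ j → ρ i j ≡ just (σ i j)
      ρ≡σ {i} {j} i≢j with known (∈-cartesianProduct⁺ (∈-allFin i) (∈-allFin j)) i≢j
      ... | v , eq = trans eq (cong just (≡-sym (cong (fromMaybe zero) eq)))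
      σ-coh : ∀ {i j} → i ≢ j → σ j i ≡ fl (σ i j)
      σ-coh i≢j = cong (fromMaybe zero) (trans (coh i≢j) (cong (Maybe.map fl) (ρ≡σ i≢j)))
      go : ∀ ks → potential ks (λ i j → just (σ i j)) ≡ potential ks ρ
      go []               = refl
      go ((js , κ) ∷ ks) = cong₂ _+_ (prod-cong λ i → factor-cong (λ i j → just (σ i j)) ρ js κ i λ i∉js j∈js →
        ≡-sym (ρ≡σ λ { refl → i∉js j∈js })) (go ks)

-- Lists of prescribed types

covering⇒long : ∀ {N} (F : List (Fin N)) → (∀ i → i ∈ F) → ¬ length F < N
covering⇒long F covered short with pigeonhole short (λ i → index (covered i))
... | i , j , i<j , eq = Fin.<⇒≢ i<j (trans (lookup-index (covered i))
        (trans (cong (lookup F) eq) (≡-sym (lookup-index (covered j)))))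

missing : ∀ {N} (F : List (Fin N)) → length F < N → ∃[ i ] i ∉ F
missing {N} F short with any? (λ i → ¬? (i ∈? F))
  where open DecMembership (_≟_ {n = N}) using (_∈?_)
... | yes found = found
... | no  absent  = contradiction short (covering⇒long F covered)
  where
  open DecMembership (_≟_ {n = N}) using (_∈?_)
  covered : ∀ i → i ∈ F
  covered i with i ∈? F
  ... | yes i∈F = i∈F
  ... | no  i∉F = contradiction (i , i∉F) absent

length-cartesianProductWith : ∀ {A B C : Set} (f : A → B → C) xs ys →
                              length (cartesianProductWith f xs ys) ≡ length xs * length ys
length-cartesianProductWith f []       ys = refl
length-cartesianProductWith f (x ∷ xs) ys = trans (length-++ (map (f x) ys))
  (cong₂ _+_ (length-map (f x) ys) (length-cartesianProductWith f xs ys))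

length-disjoint-filters : ∀ {A : Set} {P Q : A → Set} (P? : ∀ x → Dec (P x)) (Q? : ∀ x → Dec (Q x)) →
                          (∀ {x} → P x → Q x → ⊥) → ∀ xs →
                          length (filter P? xs) + length (filter Q? xs) ≤ length xs
length-disjoint-filters P? Q? disj [] = z≤n
length-disjoint-filters P? Q? disj (x ∷ xs) with P? x | Q? x | length-disjoint-filters P? Q? disj xs
... | yes Px | yes Qx | _  = contradiction Qx (disj Px)
... | yes _  | no _   | ih = s≤s ih
... | no _   | yes _  | ih = ≤-trans (≤-reflexive (+-suc _ _)) (s≤s ih)
... | no _   | no _   | ih = m≤n⇒m≤1+n ih

-- The left side is a^(n+1) + (n+1) b a^n, the first two terms of the binomial expansion of the
-- right side. For positive a and x = b / (a + b) it also reads 1 + n x ≤ (1 - x)^(-n), the form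
-- behind the numerical estimates.
bernoulli : ∀ a b n → a ^ n * (a + b) + n * b * a ^ n ≤ (a + b) ^ n * (a + b)
bernoulli a b zero    = ≤-reflexive (+-identityʳ _)
bernoulli a b (suc n) = begin
  a * a ^ n * (a + b) + suc n * b * (a * a ^ n)
    ≡⟨ expand a b n (a ^ n) ⟩
  a * (a ^ n * (a + b) + n * b * a ^ n) + b * (a ^ n * a)
    ≤⟨ +-mono-≤ (*-monoʳ-≤ a (bernoulli a b n)) (*-monoʳ-≤ b (*-mono-≤ (^-monoˡ-≤ n (m≤m+n a b)) (m≤m+n a b))) ⟩
  a * ((a + b) ^ n * (a + b)) + b * ((a + b) ^ n * (a + b))
    ≡⟨ *-distribʳ-+ ((a + b) ^ n * (a + b)) a b ⟨
  (a + b) * ((a + b) ^ n * (a + b))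
    ≡⟨ *-assoc (a + b) _ (a + b) ⟨
  (a + b) * (a + b) ^ n * (a + b) ∎
  where
  open ≤-Reasoning
  expand : ∀ a b n x → a * x * (a + b) + suc n * b * (a * x) ≡ a * (x * (a + b) + n * b * x) + b * (x * a)
  expand = solve 4 (λ a b n x → a :* x :* (a :+ b) :+ (con 1 :+ n) :* b :* (a :* x) :=
                                a :* (x :* (a :+ b) :+ n :* b :* x) :+ b :* (x :* a)) refl
    where open +-*-Solver

module _ {p : ℕ} where

  private
    A = Fin p

  total-cong : ∀ s {κ κ′ : List A → ℕ} → (∀ bs → κ bs ≡ κ′ bs) → total s κ ≡ total s κ′
  total-cong zero    eq = eq []
  total-cong (suc s) eq = sum-cong-≗ λ b → total-cong s (eq ∘ (b ∷_))

  total-+ : ∀ s (κ κ′ : List A → ℕ) → total s (λ bs → κ bs + κ′ bs) ≡ total s κ + total s κ′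
  total-+ zero    κ κ′ = refl
  total-+ (suc s) κ κ′ = trans (sum-cong-≗ λ b → total-+ s (κ ∘ (b ∷_)) (κ′ ∘ (b ∷_)))
    (∑-distrib-+ (λ b → total s (κ ∘ (b ∷_))) _)

  total-* : ∀ s l (κ : List A → ℕ) → total s (λ bs → l * κ bs) ≡ l * total s κ
  total-* zero    l κ = refl
  total-* (suc s) l κ = trans (sum-cong-≗ λ b → total-* s l (κ ∘ (b ∷_)))
    (≡-sym (*-distribˡ-sum l (λ b → total s (κ ∘ (b ∷_)))))

  total-sum : ∀ s {c} (κ : Fin c → List A → ℕ) → total s (λ bs → sum (λ x → κ x bs)) ≡ sum (λ x → total s (κ x))
  total-sum zero    κ = refl
  total-sum (suc s) κ = trans (sum-cong-≗ λ b → total-sum s (λ x → κ x ∘ (b ∷_)))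
    (∑-comm (λ b x → total s (κ x ∘ (b ∷_))))

  total-const : ∀ s l → total s (λ (_ : List A) → l) ≡ p ^ s * l
  total-const zero    l = ≡-sym (*-identityˡ l)
  total-const (suc s) l = trans (sum-cong-≗ {p} λ _ → total-const s l)
    (trans (sum-const p (p ^ s * l)) (≡-sym (*-assoc p (p ^ s) l)))

  indicator : List A → List A → ℕ
  indicator as bs = if does (≡-dec _≟_ as bs) then 1 else 0

  indicator-hit : ∀ as → indicator as as ≡ 1
  indicator-hit as with ≡-dec _≟_ as as
  ... | yes _     = refl
  ... | no  as≢as = contradiction refl as≢as

  indicator-miss : ∀ {as bs} → as ≢ bs → indicator as bs ≡ 0
  indicator-miss {as} {bs} as≢bs with ≡-dec _≟_ as bs
  ... | yes as≡bs = contradiction as≡bs as≢bs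
  ... | no  _     = refl

  indicator-∷ : ∀ a as bs → indicator (a ∷ as) (a ∷ bs) ≡ indicator as bs
  indicator-∷ a as bs = go (≡-dec _≟_ as bs)
    where
    go : Dec (as ≡ bs) → indicator (a ∷ as) (a ∷ bs) ≡ indicator as bs
    go (yes refl) = trans (indicator-hit (a ∷ as)) (≡-sym (indicator-hit as))
    go (no as≢bs) = trans (indicator-miss {a ∷ as} {a ∷ bs} (as≢bs ∘ proj₂ ∘ ∷-injective)) (≡-sym (indicator-miss as≢bs))

  total-indicator : ∀ as → total (length as) (indicator as) ≡ 1
  total-indicator []       = refl
  total-indicator (a ∷ as) = begin
    sum (λ b → total (length as) (indicator (a ∷ as) ∘ (b ∷_)))
      ≡⟨ sum-single (λ b → total (length as) (indicator (a ∷ as) ∘ (b ∷_))) a (λ b b≢a →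
           trans (total-cong (length as) λ bs → indicator-miss {a ∷ as} {b ∷ bs} (b≢a ∘ ≡-sym ∘ proj₁ ∘ ∷-injective))
             (trans (total-const (length as) 0) (*-zeroʳ (p ^ length as)))) ⟩
    total (length as) (indicator (a ∷ as) ∘ (a ∷_))
      ≡⟨ total-cong (length as) (indicator-∷ a as) ⟩
    total (length as) (indicator as)
      ≡⟨ total-indicator as ⟩
    1 ∎
    where open ≡-Reasoning

module Demands (p N : ℕ) where

  private
    A = Fin p
    Label = Fin N

  Demand : Set
  Demand = List (Label × A)

  keys : Demand → List Label
  keys = map proj₁

  values : Demand → List A
  values = map proj₂

  -- The keys form a sublist of the given labels, so that each set of keys appears in one order
  -- only; this is where the factor `s !` of `length-demands` is gained.
  demands : ℕ → List Label → List Demand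
  demands zero    _        = [] ∷ []
  demands (suc s) []       = []
  demands (suc s) (j ∷ js) = cartesianProductWith (λ a d → (j , a) ∷ d) (allFin p) (demands s js) ++ demands (suc s) js

  demands-keys : ∀ s js {d} → d ∈ demands s js → ∀ {i} → i ∈ keys d → i ∈ js
  demands-keys zero    _        (here refl) ()
  demands-keys (suc s) (j ∷ js) d∈ i∈ with ∈-++⁻ (cartesianProductWith (λ a d → (j , a) ∷ d) (allFin p) (demands s js)) d∈
  ... | inj₂ d∈′ = there (demands-keys (suc s) js d∈′ i∈)
  ... | inj₁ d∈′ with ∈-cartesianProductWith⁻ (λ a d → (j , a) ∷ d) (allFin p) (demands s js) d∈′ | i∈
  ...   | _ , _ , _ , d′∈ , refl | here refl = here refl
  ...   | _ , _ , _ , d′∈ , refl | there i∈′ = there (demands-keys s js d′∈ i∈′)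

  demands-unique : ∀ s {js d} → Unique js → d ∈ demands s js → Unique (keys d)
  demands-unique zero    _ (here refl) = []
  demands-unique (suc s) {j ∷ js} (j∉js ∷ js!) d∈ with ∈-++⁻ (cartesianProductWith (λ a d → (j , a) ∷ d) (allFin p) (demands s js)) d∈
  ... | inj₂ d∈′ = demands-unique (suc s) js! d∈′
  ... | inj₁ d∈′ with ∈-cartesianProductWith⁻ (λ a d → (j , a) ∷ d) (allFin p) (demands s js) d∈′
  ...   | _ , _ , _ , d′∈ , refl = All.tabulate (λ i∈ → All.lookup j∉js (demands-keys s js d′∈ i∈)) ∷ demands-unique s js! d′∈

  demands-length : ∀ s js {d} → d ∈ demands s js → length d ≡ s
  demands-length zero    _        (here refl) = refl
  demands-length (suc s) (j ∷ js) d∈ with ∈-++⁻ (cartesianProductWith (λ a d → (j , a) ∷ d) (allFin p) (demands s js)) d∈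
  ... | inj₂ d∈′ = demands-length (suc s) js d∈′
  ... | inj₁ d∈′ with ∈-cartesianProductWith⁻ (λ a d → (j , a) ∷ d) (allFin p) (demands s js) d∈′
  ...   | _ , _ , _ , d′∈ , refl = cong suc (demands-length s js d′∈)

  -- With n = `length js` there are binom(n, s) p^s demands, and s! binom(n, s) ≤ n^s. The recursion
  -- is Pascal's rule, and `bernoulli` bounds its two terms together.
  length-demands : ∀ s js → s ! * length (demands s js) ≤ (length js * p) ^ s
  length-demands zero    _        = ≤-refl
  length-demands (suc s) []       = ≤-reflexive (*-zeroʳ (suc s !))
  length-demands (suc s) (j ∷ js) = begin
    suc s ! * length (demands (suc s) (j ∷ js))
      ≡⟨ cong (suc s ! *_) (trans (length-++ (cartesianProductWith (λ a d → (j , a) ∷ d) (allFin p) (demands s js))) (cong (_+ r)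
           (trans (length-cartesianProductWith _ (allFin p) (demands s js)) (cong (_* q) (length-tabulate {n = p} id))))) ⟩
    suc s * s ! * (p * q + r)
      ≡⟨ regroup s (s !) p q r ⟩
    suc s * p * (s ! * q) + suc s ! * r
      ≤⟨ +-mono-≤ (*-monoʳ-≤ (suc s * p) (length-demands s js)) (length-demands (suc s) js) ⟩
    suc s * p * (n * p) ^ s + (n * p) * (n * p) ^ s
      ≡⟨ regroup′ s p n ((n * p) ^ s) ⟩
    (n * p) ^ s * (n * p + p) + s * p * (n * p) ^ s
      ≤⟨ bernoulli (n * p) p s ⟩
    (n * p + p) ^ s * (n * p + p)
      ≡⟨ trans (*-comm _ (n * p + p)) (cong (λ z → z * z ^ s) (+-comm (n * p) p)) ⟩
    (suc n * p) ^ suc s ∎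
    where
    open ≤-Reasoning
    n = length js
    q = length (demands s js)
    r = length (demands (suc s) js)
    regroup : ∀ s f p q r → suc s * f * (p * q + r) ≡ suc s * p * (f * q) + suc s * f * r
    regroup = solve 5 (λ s f p q r → (con 1 :+ s) :* f :* (p :* q :+ r) :=
                         (con 1 :+ s) :* p :* (f :* q) :+ (con 1 :+ s) :* f :* r) refl
      where open +-*-Solver
    regroup′ : ∀ s p n x → suc s * p * x + n * p * x ≡ x * (n * p + p) + s * p * x
    regroup′ = solve 4 (λ s p n x → (con 1 :+ s) :* p :* x :+ n :* p :* x :=
                          x :* (n :* p :+ p) :+ s :* p :* x) refl
      where open +-*-Solver

  collect : (Label → Maybe A) → List Label → Demand
  collect f []       = []
  collect f (j ∷ js) with f j
  ... | nothing = collect f js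
  ... | just a  = (j , a) ∷ collect f js

  collect-∈-demands : ∀ f js → collect f js ∈ demands (length (collect f js)) js
  collect-∈-demands f []       = here refl
  collect-∈-demands f (j ∷ js) with f j
  ... | just a  = ∈-++⁺ˡ (∈-cartesianProductWith⁺ (λ a d → (j , a) ∷ d) (∈-allFin a) (collect-∈-demands f js))
  ... | nothing with length (collect f js) | collect-∈-demands f js
  ...   | zero  | here eq = here eq
  ...   | suc s | d∈      = ∈-++⁺ʳ _ d∈

  ∈-collect : ∀ f {j a} js → j ∈ js → f j ≡ just a → (j , a) ∈ collect f js
  ∈-collect f (j ∷ js) (here refl) eq with f j | eq
  ... | just a | refl = here refl
  ∈-collect f (i ∷ js) (there j∈js) eq with f i
  ... | nothing = ∈-collect f js j∈js eq
  ... | just _  = there (∈-collect f js j∈js eq)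

  collect-cong : ∀ {f g} js → (∀ {i} → i ∈ js → f i ≡ g i) → collect f js ≡ collect g js
  collect-cong []       _  = refl
  collect-cong {f} {g} (j ∷ js) eq with f j | g j | eq (here refl)
  ... | nothing | nothing | _    = collect-cong js (eq ∘ there)
  ... | just a  | just a  | refl = cong ((j , a) ∷_) (collect-cong js (eq ∘ there))

  collect-just : ∀ f {j a} js → f j ≡ just a → collect f (j ∷ js) ≡ (j , a) ∷ collect f js
  collect-just f {j} js eq with f j | eq
  ... | _ | refl = refl

  collect-nothing : ∀ f {j} js → f j ≡ nothing → collect f (j ∷ js) ≡ collect f js
  collect-nothing f {j} js eq with f j | eq
  ... | _ | refl = refl

  length-collect-override : ∀ f j a → f j ≡ nothing → ∀ js → Unique js → j ∈ js →
                            length (collect (override f j (just a)) js) ≡ suc (length (collect f js))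
  length-collect-override f j a fj (j ∷ js) (j∉js ∷ _) (here refl) = trans
    (cong length (collect-just (override f j (just a)) js (override-here f j (just a))))
    (cong (suc ∘ length) (trans
      (collect-cong js λ i∈js → override-there f j _ λ { refl → All.lookup j∉js i∈js refl })
      (≡-sym (collect-nothing f js fj))))
  length-collect-override f j a fj (i ∷ js) (i∉js ∷ js!) (there j∈js) = go (f i) refl
    where
    f′ = override f j (just a)
    f′≡f = override-there f j (just a) (All.lookup i∉js j∈js)
    ih = length-collect-override f j a fj js js! j∈js
    go : ∀ m → f i ≡ m → length (collect f′ (i ∷ js)) ≡ suc (length (collect f (i ∷ js)))
    go nothing  fi = trans (cong length (collect-nothing f′ js (trans f′≡f fi)))
      (trans ih (cong (suc ∘ length) (≡-sym (collect-nothing f js fi))))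
    go (just b) fi = trans (cong length (collect-just f′ js (trans f′≡f fi)))
      (trans (cong suc ih) (cong (suc ∘ length) (≡-sym (collect-just f js fi))))

  asFunction : Demand → Label → Maybe A
  asFunction []            = λ _ → nothing
  asFunction ((j , a) ∷ d) = override (asFunction d) j (just a)

  asFunction-∉ : ∀ d {j} → j ∉ keys d → asFunction d j ≡ nothing
  asFunction-∉ []            _  = refl
  asFunction-∉ ((i , a) ∷ d) j∉ = trans (override-there (asFunction d) i _ (j∉ ∘ here)) (asFunction-∉ d (j∉ ∘ there))

  asFunction-∈ : ∀ d {j a} → Unique (keys d) → (j , a) ∈ d → asFunction d j ≡ just a
  asFunction-∈ ((j , a) ∷ d) _ (here refl) = override-here (asFunction d) j _
  asFunction-∈ ((i , _) ∷ d) (i∉ ∷ d!) (there ja∈d) = trans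
    (override-there (asFunction d) i _ (All.lookup i∉ (∈-map⁺ proj₁ ja∈d) ∘ ≡-sym)) (asFunction-∈ d d! ja∈d)

  -- The union bound covers only demands whose keys follow the order of `allFin N`. A demand with
  -- unique keys is a partial function, and reading that function along `allFin N` produces this
  -- order.
  sort : Demand → Demand
  sort d = collect (asFunction d) (allFin N)

  length-sort : ∀ d → Unique (keys d) → length (sort d) ≡ length d
  length-sort []            _         = cong length (go (allFin N))
    where
    go : ∀ js → collect (λ _ → nothing) js ≡ []
    go []       = refl
    go (_ ∷ js) = go js
  length-sort ((j , a) ∷ d) (j∉ ∷ d!) = trans
    (length-collect-override (asFunction d) j a (asFunction-∉ d λ j∈ → All.lookup j∉ j∈ refl) (allFin N) (allFin⁺ N) (∈-allFin j))
    (cong suc (length-sort d d!))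

  ∈-sort : ∀ d → Unique (keys d) → ∀ {ja} → ja ∈ d → ja ∈ sort d
  ∈-sort d d! {j , a} ja∈d = ∈-collect (asFunction d) (allFin N) (∈-allFin j) (asFunction-∈ d d! ja∈d)

-- Existence of an extendable matrix

sumᴸ-bound : ∀ {B : Set} (f : B → ℕ) x y ks → (∀ {k} → k ∈ ks → f k * x ≤ y) → sumᴸ (map f ks) * x ≤ length ks * y
sumᴸ-bound f x y []       _  = z≤n
sumᴸ-bound f x y (k ∷ ks) le = begin
  (f k + sumᴸ (map f ks)) * x     ≡⟨ *-distribʳ-+ x (f k) _ ⟩
  f k * x + sumᴸ (map f ks) * x   ≤⟨ +-mono-≤ (le (here refl)) (sumᴸ-bound f x y ks (le ∘ there)) ⟩
  y + length ks * y               ∎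
  where open ≤-Reasoning

∈⇒≤sumᴸ : ∀ {B : Set} (f : B → ℕ) {k ks} → k ∈ ks → f k ≤ sumᴸ (map f ks)
∈⇒≤sumᴸ f (here refl)  = m≤m+n _ _
∈⇒≤sumᴸ f (there k∈ks) = ≤-trans (∈⇒≤sumᴸ f k∈ks) (m≤n+m _ _)

-- Each label carries c vertices, which differ by shifts act x of the connection types.
record Palette (p c : ℕ) : Set where
  field
    fl       : Fin p → Fin p
    act      : Fin c → Fin p → Fin p
    fl-inv   : ∀ a → fl (fl a) ≡ a
    act-inv  : ∀ x a → act x (act x a) ≡ a
    act-comm : ∀ x y a → act x (act y a) ≡ act y (act x a)
    act-fl   : ∀ x a → act x (fl a) ≡ fl (act x a)
    act-free : ∀ {x y} a → act x a ≡ act y a → x ≡ y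

module Extension {p″ c′ : ℕ} (𝒫 : Palette (suc (suc p″)) (suc c′)) (N : ℕ) where

  open Palette 𝒫

  private
    p c : ℕ
    p = suc (suc p″)
    c = suc c′
    A Label Row : Set
    A = Fin p
    Label = Fin N
    Row = Label → A

  open DecMembership (_≟_ {n = N}) using (_∈?_)
  open Demands p N

  Fits : Row → Fin c → Demand → Set
  Fits r x = All λ (j , a) → act x (r j) ≡ a

  -- The condition `i ∉ keys d` is there because vertices with a common label are not linked.
  Extendable : (Label → Row) → ℕ → Set
  Extendable σ t = ∀ u d F → Unique (keys d) → length d + u ≡ t → length F ≤ suc u * (t ∸ 1) →
                   ∃[ i ] ∃[ x ] i ∉ F × i ∉ keys d × Fits (σ i) x d

  -- The shift is applied to the prescribed values and not to the row, so that the rows serving a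
  -- fixed demand can be counted as its shifts. Since `act x` is an involution, `match⇒fits` turns
  -- this back into `Fits`.
  match? : (as bs : List A) → Dec (∃[ x ] map (act x) as ≡ bs)
  match? as bs = any? λ x → ≡-dec _≟_ (map (act x) as) bs

  map-act-free : ∀ {x y} a as → map (act x) (a ∷ as) ≡ map (act y) (a ∷ as) → x ≡ y
  map-act-free a as eq = act-free a (proj₁ (∷-injective eq))

  match⇒fits : ∀ r x d → map (act x) (values d) ≡ map r (keys d) → Fits r x d
  match⇒fits r x []            _  = []
  match⇒fits r x ((j , a) ∷ d) eq with ∷-injective eq
  ... | eq₁ , eq₂ = trans (cong (act x) (≡-sym eq₁)) (act-inv x a) ∷ match⇒fits r x d eq₂

  module _ (l : ℕ) where

    -- Exponential (Chernoff) weight: each label serving a demand divides its cost by suc l.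
    penalty : List A → List A → ℕ
    penalty as bs = if does (match? as bs) then 1 else suc l

    penalty-≥1 : ∀ as bs → 1 ≤ penalty as bs
    penalty-≥1 as bs = go (does (match? as bs))
      where
      go : ∀ b → 1 ≤ (if b then 1 else suc l)
      go true  = ≤-refl
      go false = s≤s z≤n

    penalty-miss : ∀ as bs → ¬ (∃[ x ] map (act x) as ≡ bs) → penalty as bs ≡ suc l
    penalty-miss as bs absent = go (match? as bs)
      where
      go : (m : Dec (∃[ x ] map (act x) as ≡ bs)) → (if does m then 1 else suc l) ≡ suc l
      go (yes found) = contradiction found absent
      go (no  _)     = refl

    -- By `act-free` the shifts of a non-empty list are distinct, so at most one indicator is 1.
    -- This replaces the case distinction in `penalty` by a sum that can be totalled term by term.
    penalty-+ : ∀ a as bs → penalty (a ∷ as) bs + l * sum (λ x → indicator (map (act x) (a ∷ as)) bs) ≡ suc l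
    penalty-+ a as bs = go (match? (a ∷ as) bs)
      where
      shifts : Fin c → List A
      shifts x = map (act x) (a ∷ as)
      go : (m : Dec (∃[ x ] shifts x ≡ bs)) → (if does m then 1 else suc l) + l * sum (λ x → indicator (shifts x) bs) ≡ suc l
      go (yes (x , refl)) = cong suc (trans (cong (l *_) (trans
        (sum-single (λ y → indicator (shifts y) (shifts x)) x
          (λ y y≢x → indicator-miss {as = shifts y} {shifts x} (y≢x ∘ map-act-free a as)))
        (indicator-hit (shifts x)))) (*-identityʳ l))
      go (no absent) = trans (cong (λ z → suc l + l * z) (trans
        (sum-cong-≗ {c} (λ x → indicator-miss {as = shifts x} {bs} (λ eq → absent (x , eq)))) (sum-replicate-zero c)))
        (trans (cong (suc l +_) (*-zeroʳ l)) (+-identityʳ (suc l)))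

    -- Exactly `c` of the lists of this length are shifts of `a ∷ as`, and each of them saves `l`.
    total-penalty : ∀ a as → total (suc (length as)) (penalty (a ∷ as)) + l * c ≡ suc l * p ^ suc (length as)
    total-penalty a as = begin
      total s (penalty (a ∷ as)) + l * c
        ≡⟨ cong (λ z → total s (penalty (a ∷ as)) + l * z) (trans (sum-const c 1) (*-identityʳ c)) ⟨
      total s (penalty (a ∷ as)) + l * sum {c} (λ _ → 1)
        ≡⟨ cong (λ z → total s (penalty (a ∷ as)) + l * z) (sum-cong-≗ λ x → trans
             (cong (λ n → total n (indicator (map (act x) (a ∷ as)))) (≡-sym (length-map (act x) (a ∷ as))))
             (total-indicator (map (act x) (a ∷ as)))) ⟨
      total s (penalty (a ∷ as)) + l * sum (λ x → total s (indicator (map (act x) (a ∷ as))))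
        ≡⟨ cong (λ z → total s (penalty (a ∷ as)) + l * z) (total-sum s (λ x → indicator (map (act x) (a ∷ as)))) ⟨
      total s (penalty (a ∷ as)) + l * total s hits
        ≡⟨ cong (total s (penalty (a ∷ as)) +_) (total-* s l hits) ⟨
      total s (penalty (a ∷ as)) + total s (λ bs → l * hits bs)
        ≡⟨ total-+ s (penalty (a ∷ as)) (λ bs → l * hits bs) ⟨
      total s (λ bs → penalty (a ∷ as) bs + l * hits bs)
        ≡⟨ total-cong s (penalty-+ a as) ⟩
      total s (λ _ → suc l)
        ≡⟨ total-const s (suc l) ⟩
      p ^ s * suc l
        ≡⟨ *-comm (p ^ s) (suc l) ⟩
      suc l * p ^ s ∎
      where
      open ≡-Reasoning
      s = suc (length as)
      hits : List A → ℕ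
      hits bs = sum (λ x → indicator (map (act x) (a ∷ as)) bs)

    -- C is the weight of a label that cannot serve a demand, w the mean weight of an undecided one.
    module _ (r w : ℕ) (w+ : w + l * c ≡ suc l * p ^ suc r)
             (sparse : (N * p) ^ suc r * w ^ N * (suc l * p ^ suc r) ^ suc r * suc l ^ r
                       < suc r ! * ((suc l * p ^ suc r) ^ N * w ^ suc r)) where

      private
        t C : ℕ
        t = suc r
        C = suc l * p ^ t

      open Selection fl fl-inv N C

      private
        ds : List Demand
        ds = demands t (allFin N)

        test : Demand → Test
        test d = keys d , penalty (values d)

        tests-unique : All (Unique ∘ proj₁) (map test ds)
        tests-unique = All.tabulate λ k∈ → let d , d∈ , eq = ∈-map⁻ test k∈ in
          subst (Unique ∘ proj₁) (≡-sym eq) (demands-unique t (allFin⁺ N) d∈)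

        blank : State
        blank _ _ = nothing

        total≡w : ∀ d → length d ≡ t → total (length (keys d)) (penalty (values d)) ≡ w
        total≡w ((j , a) ∷ d) eq = +-cancelʳ-≡ (l * c) _ w (begin
          total (suc (length (keys d))) (penalty (a ∷ values d)) + l * c
            ≡⟨ cong (λ s → total (suc s) (penalty (a ∷ values d)) + l * c) (trans (length-map proj₁ d) (≡-sym (length-map proj₂ d))) ⟩
          total (suc (length (values d))) (penalty (a ∷ values d)) + l * c
            ≡⟨ total-penalty a (values d) ⟩
          suc l * p ^ suc (length (values d))
            ≡⟨ cong (λ s → suc l * p ^ s) (trans (cong suc (length-map proj₂ d)) eq) ⟩
          C ≡⟨ w+ ⟨
          w + l * c ∎)
          where open ≡-Reasoning

        w≤C : w ≤ C
        w≤C = subst (w ≤_) w+ (m≤m+n w (l * c))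

        -- The `t` keys weigh `C` instead of `w`; this is the price `(C / w) ^ t` that `prod-upper`
        -- charges.
        cost-blank : ∀ {d} → d ∈ ds → cost blank (test d) * w ^ t ≤ w ^ N * C ^ t
        cost-blank {d} d∈ = subst (λ s → cost blank (test d) * w ^ s ≤ w ^ N * C ^ s)
          (trans (length-map proj₁ d) |d|≡t)
          (prod-upper C w (keys d) (factor blank (test d)) w≤C below out)
          where
          |d|≡t = demands-length t (allFin N) d∈
          out : ∀ i → i ∉ keys d → factor blank (test d) i ≤ w
          out i i∉ = ≤-reflexive (trans (factor-out {blank} {κ = penalty (values d)} i∉)
            (trans (weigh-blank (keys d) (penalty (values d))) (total≡w d |d|≡t)))
          below : ∀ i → factor blank (test d) i ≤ C
          below i with i ∈? keys d in eq
          ... | yes i∈ = ≤-refl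
          ... | no  i∉ = ≤-trans (≤-reflexive (trans (weigh-blank (keys d) (penalty (values d))) (total≡w d |d|≡t))) w≤C

        potential-blank : t ! * (potential (map test ds) blank * w ^ t) ≤ (N * p) ^ t * w ^ N * C ^ t
        potential-blank = begin
          t ! * (potential (map test ds) blank * w ^ t)
            ≤⟨ *-monoʳ-≤ (t !) (sumᴸ-bound (cost blank) (w ^ t) (w ^ N * C ^ t) (map test ds)
                 λ k∈ → let d , d∈ , eq = ∈-map⁻ test k∈ in subst (λ k → cost blank k * w ^ t ≤ w ^ N * C ^ t) (≡-sym eq) (cost-blank d∈)) ⟩
          t ! * (length (map test ds) * (w ^ N * C ^ t))
            ≡⟨ cong (λ n → t ! * (n * (w ^ N * C ^ t))) (length-map test ds) ⟩
          t ! * (length ds * (w ^ N * C ^ t))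
            ≡⟨ *-assoc (t !) (length ds) _ ⟨
          t ! * length ds * (w ^ N * C ^ t)
            ≤⟨ *-monoˡ-≤ (w ^ N * C ^ t) (length-demands t (allFin N)) ⟩
          (length (allFin N) * p) ^ t * (w ^ N * C ^ t)
            ≡⟨ cong (λ n → (n * p) ^ t * (w ^ N * C ^ t)) (length-tabulate {n = N} id) ⟩
          (N * p) ^ t * (w ^ N * C ^ t)
            ≡⟨ *-assoc ((N * p) ^ t) (w ^ N) _ ⟨
          (N * p) ^ t * w ^ N * C ^ t ∎
          where open ≤-Reasoning

        module _ (σ : Label → Row)
                 (σ-small : potential (map test ds) (λ i j → just (σ i j)) ≤ potential (map test ds) blank) where

          full : State
          full i j = just (σ i j)

          Serves : Demand → List Label → Label → Set
          Serves d F i = i ∉ F × i ∉ keys d × (∃[ x ] map (act x) (values d) ≡ map (σ i) (keys d))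

          serves? : ∀ d F i → Dec (Serves d F i)
          serves? d F i = ¬? (i ∈? F) ×-dec ¬? (i ∈? keys d) ×-dec match? (values d) (map (σ i) (keys d))

          factor-full : ∀ {d} → d ∈ ds → ∀ {i} → i ∉ keys d →
                        factor full (test d) i ≡ p ^ t * penalty (values d) (map (σ i) (keys d))
          factor-full {d} d∈ {i} i∉ = trans (factor-out {full} {κ = penalty (values d)} i∉)
            (trans (weigh-known (full i) (σ i) (keys d) (penalty (values d)) (λ _ → refl))
              (cong (λ s → p ^ s * penalty (values d) (map (σ i) (keys d)))
                (trans (length-map proj₁ d) (demands-length t (allFin N) d∈))))

          unserved : ∀ {d} F → d ∈ ds → ¬ (∃[ i ] Serves d F i) → C ^ N ≤ cost full (test d) * suc l ^ length F
          unserved {d} F d∈ absent = prod-lower C (suc l) F (factor full (test d)) above out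
            where
            above : ∀ i → C ≤ factor full (test d) i * suc l
            above i = go (i ∈? keys d)
              where
              go : Dec (i ∈ keys d) → C ≤ factor full (test d) i * suc l
              go (yes i∈) = subst (λ z → C ≤ z * suc l) (≡-sym (factor-in {full} {κ = penalty (values d)} i∈)) (m≤m*n C (suc l))
              go (no  i∉) = subst (λ z → C ≤ z * suc l) (≡-sym (factor-full d∈ i∉))
                (≤-trans (≤-reflexive (*-comm (suc l) (p ^ t)))
                  (*-monoˡ-≤ (suc l) (≤-trans (≤-reflexive (≡-sym (*-identityʳ (p ^ t))))
                    (*-monoʳ-≤ (p ^ t) (penalty-≥1 (values d) (map (σ i) (keys d)))))))
            out : ∀ i → i ∉ F → C ≤ factor full (test d) i
            out i i∉F = go (i ∈? keys d)
              where
              go : Dec (i ∈ keys d) → C ≤ factor full (test d) i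
              go (yes i∈) = ≤-reflexive (≡-sym (factor-in {full} {κ = penalty (values d)} i∈))
              go (no  i∉) = ≤-reflexive (≡-sym (trans (factor-full d∈ i∉)
                (trans (cong (p ^ t *_) (penalty-miss (values d) _ λ m → absent (i , i∉F , i∉ , m))) (*-comm (p ^ t) (suc l)))))

          -- If only labels of `F` served the demand, all others would keep the weight `C` and those
          -- of `F` at least `C / suc l`. This single cost would then be at least
          -- `C ^ N / suc l ^ r`, which by `sparse` exceeds the bound on the whole potential.
          served : ∀ {d} F → d ∈ ds → length F ≤ r → ∃[ i ] Serves d F i
          served {d} F d∈ |F|≤r with any? (serves? d F)
          ... | yes found = found
          ... | no  absent  = contradiction sparse (≤⇒≯ (begin
            t ! * (C ^ N * w ^ t)
              ≤⟨ *-monoʳ-≤ (t !) (*-monoˡ-≤ (w ^ t) (unserved F d∈ absent)) ⟩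
            t ! * (cost full (test d) * suc l ^ length F * w ^ t)
              ≤⟨ *-monoʳ-≤ (t !) (*-monoˡ-≤ (w ^ t) (*-mono-≤
                   (≤-trans (∈⇒≤sumᴸ (cost full) (∈-map⁺ test d∈)) σ-small) (^-monoʳ-≤ (suc l) |F|≤r))) ⟩
            t ! * (Φ * suc l ^ r * w ^ t)
              ≡⟨ regroup (t !) Φ (suc l ^ r) (w ^ t) ⟩
            t ! * (Φ * w ^ t) * suc l ^ r
              ≤⟨ *-monoˡ-≤ (suc l ^ r) potential-blank ⟩
            (N * p) ^ t * w ^ N * C ^ t * suc l ^ r ∎))
            where
            open ≤-Reasoning
            Φ = potential (map test ds) blank
            regroup : ∀ a b c d → a * (b * c * d) ≡ a * (b * d) * c
            regroup = solve 4 (λ a b c d → a :* (b :* c :* d) := a :* (b :* d) :* c) refl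
              where open +-*-Solver

          extend₀ : ∀ d F → Unique (keys d) → length d ≡ t → length F ≤ r →
                    ∃[ i ] ∃[ x ] i ∉ F × i ∉ keys d × Fits (σ i) x d
          extend₀ d F d! |d|≡t |F|≤r
            with served F (subst (λ s → sort d ∈ demands s (allFin N)) (trans (length-sort d d!) |d|≡t)
                             (collect-∈-demands (asFunction d) (allFin N))) |F|≤r
          ... | i , i∉F , i∉ , x , eq = i , x , i∉F , i∉d , All.tabulate (All.lookup fits ∘ ∈-sort d d!)
            where
            fits : Fits (σ i) x (sort d)
            fits = match⇒fits (σ i) x (sort d) eq
            i∉d : i ∉ keys d
            i∉d i∈ with ∈-map⁻ proj₁ i∈
            ... | ja , ja∈d , eq = i∉ (subst (_∈ keys (sort d)) (≡-sym eq) (∈-map⁺ proj₁ (∈-sort d d! ja∈d)))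

          fits? : ∀ i x d → Dec (Fits (σ i) x d)
          fits? i x = All.all? λ (j , a) → act x (σ i j) ≟ a

          fits-shift-unique : ∀ {i x y} j a d → Fits (σ i) x ((j , a) ∷ d) → Fits (σ i) y ((j , a) ∷ d) → x ≡ y
          fits-shift-unique {i} j a d (e ∷ _) (e′ ∷ _) = act-free (σ i j) (trans e (≡-sym e′))

          -- With few keys left to prescribe, add one unused key; of two values for it,
          -- one is compatible with at most half of the forbidden labels.
          extend : suc t * r < N → ∀ u d F → Unique (keys d) → length d + u ≡ t → length F ≤ suc u * r →
                   ∃[ i ] ∃[ x ] i ∉ F × i ∉ keys d × Fits (σ i) x d
          extend N> zero    d F d! |d| |F|≤ = extend₀ d F d! (trans (≡-sym (+-identityʳ _)) |d|) (subst (length F ≤_) (+-identityʳ r) |F|≤)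
          extend N> (suc u) [] F d! |d| |F|≤ with missing F (≤-<-trans |F|≤ (subst (λ s → suc s * r < N) (≡-sym |d|) N>))
          ... | i , i∉F = i , zero , i∉F , (λ ()) , []
          extend N> (suc u) d@((j₀ , a₀) ∷ d₀) F d! |d| |F|≤ = choose (≤-total (length (Fₐ zero)) (length (Fₐ (suc zero))))
            where
            |d|≤r : length d ≤ r
            |d|≤r = s≤s⁻¹ (subst (suc (length d) ≤_) (trans (≡-sym (+-suc (length d) u)) |d|) (s≤s (m≤m+n (length d) u)))
            unused = missing (keys d) (≤-<-trans (≤-trans (≤-reflexive (length-map proj₁ d)) (≤-trans |d|≤r (m≤m+n r (t * r)))) N>)
            j = proj₁ unused
            j∉d = proj₂ unused
            Hit : A → Label → Set
            Hit a i = ∃[ x ] Fits (σ i) x ((j , a) ∷ d)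
            hit? : ∀ a i → Dec (Hit a i)
            hit? a i = any? λ x → fits? i x ((j , a) ∷ d)
            Fₐ : A → List Label
            Fₐ a = filter (hit? a) F
            -- The key `j₀` of the non-empty demand already determines the shift, so `x` and `y`
            -- agree and the type at `j` would be both `zero` and `suc zero`.
            disjoint : ∀ {i} → Hit zero i → Hit (suc zero) i → ⊥
            disjoint {i} (x , e ∷ fit) (y , e′ ∷ fit′) with fits-shift-unique j₀ a₀ d₀ fit fit′
            ... | refl with trans (≡-sym e) e′
            ...   | ()
            halves : length (Fₐ zero) + length (Fₐ (suc zero)) ≤ suc (suc u) * r
            halves = ≤-trans (length-disjoint-filters (hit? zero) (hit? (suc zero)) disjoint F) |F|≤
            half : ∀ {m n} → m ≤ n → m + n ≤ suc (suc u) * r → m ≤ suc u * r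
            half {m} {n} m≤n m+n≤ = *-cancelˡ-≤ 2 (begin
              2 * m               ≡⟨ cong (m +_) (+-identityʳ m) ⟩
              m + m               ≤⟨ +-monoʳ-≤ m m≤n ⟩
              m + n               ≤⟨ m+n≤ ⟩
              suc (suc u) * r     ≤⟨ *-monoˡ-≤ r (s≤s (s≤s (m≤m+n u (u + 0)))) ⟩
              suc (suc (2 * u)) * r ≡⟨ double u r ⟩
              2 * (suc u * r)     ∎)
              where
              open ≤-Reasoning
              double : ∀ u r → suc (suc (2 * u)) * r ≡ 2 * (suc u * r)
              double = solve 2 (λ u r → (con 2 :+ con 2 :* u) :* r := con 2 :* ((con 1 :+ u) :* r)) refl
                where open +-*-Solver
            -- A label of `F` that meets the longer demand lies in `Fₐ a`; avoiding `Fₐ a` therefore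
            -- amounts to avoiding `F`.
            apply : ∀ a → length (Fₐ a) ≤ suc u * r → ∃[ i ] ∃[ x ] i ∉ F × i ∉ keys d × Fits (σ i) x d
            apply a le with extend N> u ((j , a) ∷ d) (Fₐ a) (All.tabulate (λ {i} i∈ eq → j∉d (subst (_∈ keys d) (≡-sym eq) i∈)) ∷ d!)
                              (trans (≡-sym (+-suc (length d) u)) |d|) le
            ... | i , x , i∉Fₐ , i∉ , fit@(_ ∷ fit′) =
                  i , x , (λ i∈F → i∉Fₐ (∈-filter⁺ (hit? a) i∈F (x , fit))) , i∉ ∘ there , fit′
            choose : length (Fₐ zero) ≤ length (Fₐ (suc zero)) ⊎ length (Fₐ (suc zero)) ≤ length (Fₐ zero) →
                     ∃[ i ] ∃[ x ] i ∉ F × i ∉ keys d × Fits (σ i) x d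
            choose (inj₁ le) = apply zero (half le halves)
            choose (inj₂ le) = apply (suc zero) (half le (≤-trans (≤-reflexive (+-comm (length (Fₐ (suc zero))) _)) halves))

      extendable : suc t * r < N → ∃[ σ ] (∀ {i j} → i ≢ j → σ j i ≡ fl (σ i j)) × Extendable σ t
      extendable N> with select (map test ds) tests-unique
      ... | σ , coh , small = σ , coh , extend σ small N>

-- Greedy colouring

record Coding (m n p : ℕ) : Set where
  field
    decode           : Fin p → Conn m n
    encode           : ∀ τ → τ ≢ none → ∃[ a ] decode a ≡ τ
    decode≢none      : ∀ a → decode a ≢ none
    decode-injective : ∀ {a b} → decode a ≡ decode b → a ≡ b

  flipC≢none : ∀ {τ : Conn m n} → τ ≢ none → flipC τ ≢ none
  flipC≢none {none}     τ≢none _ = τ≢none refl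
  flipC≢none {arcOut _} _ ()
  flipC≢none {arcIn _}  _ ()
  flipC≢none {edge _}   _ ()

  flipC-involutive : ∀ (τ : Conn m n) → flipC (flipC τ) ≡ τ
  flipC-involutive none       = refl
  flipC-involutive (arcOut _) = refl
  flipC-involutive (arcIn _)  = refl
  flipC-involutive (edge _)   = refl

  flip : Fin p → Fin p
  flip a = proj₁ (encode (flipC (decode a)) (flipC≢none (decode≢none a)))

  decode-flip : ∀ a → decode (flip a) ≡ flipC (decode a)
  decode-flip a = proj₂ (encode (flipC (decode a)) (flipC≢none (decode≢none a)))

  flip-involutive : ∀ a → flip (flip a) ≡ a
  flip-involutive a = decode-injective (trans (decode-flip (flip a))
    (trans (cong flipC (decode-flip a)) (flipC-involutive (decode a))))

coding : ∀ m n → Coding m n (2 * m + n)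
coding m n = record
  { decode           = dec
  ; encode           = enc
  ; decode≢none      = λ a → nonempty (splitAt (2 * m) a)
  ; decode-injective = λ {a} {b} eq → just-injective (trans (≡-sym (left a)) (trans (cong back eq) (left b)))
  }
  where
  -- Each arc colour gives two types, one per direction. The sum `2 * m` unfolds to `m + (m + 0)`,
  -- which leaves an empty `Fin 0` behind the incoming arcs.
  arcs : Fin m ⊎ Fin (m + 0) → Conn m n
  arcs (inj₁ i) = arcOut i
  arcs (inj₂ i) = [ arcIn , (λ ()) ]′ (splitAt m i)
  all : Fin (2 * m) ⊎ Fin n → Conn m n
  all (inj₁ i) = arcs (splitAt m i)
  all (inj₂ j) = edge j
  dec : Fin (2 * m + n) → Conn m n
  dec a = all (splitAt (2 * m) a)
  outs ins : Fin m → Fin (2 * m + n)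
  outs i = (i ↑ˡ (m + 0)) ↑ˡ n
  ins  i = (m ↑ʳ (i ↑ˡ 0)) ↑ˡ n
  enc : ∀ τ → τ ≢ none → ∃[ a ] dec a ≡ τ
  enc none       τ≢none = contradiction refl τ≢none
  enc (arcOut i) _ = outs i , trans (cong all (splitAt-↑ˡ (2 * m) (i ↑ˡ (m + 0)) n)) (cong arcs (splitAt-↑ˡ m i (m + 0)))
  enc (arcIn i)  _ = ins i , trans (cong all (splitAt-↑ˡ (2 * m) (m ↑ʳ (i ↑ˡ 0)) n))
    (trans (cong arcs (splitAt-↑ʳ m (m + 0) (i ↑ˡ 0))) (cong [ arcIn , (λ ()) ]′ (splitAt-↑ˡ m i 0)))
  enc (edge j)   _ = (2 * m) ↑ʳ j , cong all (splitAt-↑ʳ (2 * m) n j)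
  nonempty : ∀ s → all s ≢ none
  nonempty (inj₂ j) ()
  nonempty (inj₁ i) with splitAt m i
  ... | inj₁ _ = λ ()
  ... | inj₂ i′ with splitAt m i′
  ...   | inj₁ _ = λ ()
  back : Conn m n → Maybe (Fin (2 * m + n))
  back none       = nothing
  back (arcOut i) = just (outs i)
  back (arcIn i)  = just (ins i)
  back (edge j)   = just ((2 * m) ↑ʳ j)
  left : ∀ a → back (dec a) ≡ just a
  left a with splitAt (2 * m) a in eq
  ... | inj₂ j = cong just (splitAt⁻¹-↑ʳ eq)
  ... | inj₁ i with splitAt m i in eq′
  ...   | inj₁ i′ = cong just (trans (cong (_↑ˡ n) (splitAt⁻¹-↑ˡ eq′)) (splitAt⁻¹-↑ˡ eq))
  ...   | inj₂ i′ with splitAt m i′ in eq″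
  ...     | inj₁ i″ = cong just (trans (cong (_↑ˡ n) (trans (cong (m ↑ʳ_) (splitAt⁻¹-↑ˡ eq″)) (splitAt⁻¹-↑ʳ eq′))) (splitAt⁻¹-↑ˡ eq))

∧-true⁻ : ∀ {a b} → a ∧ b ≡ true → a ≡ true × b ≡ true
∧-true⁻ {true} {true} _ = refl , refl

module _ {k : ℕ} where

  elements : (Fin k → Bool) → List (Fin k)
  elements P = filter (λ x → P x ≟ᴮ true) (allFin k)

  ∈-elements⁺ : ∀ P {x} → P x ≡ true → x ∈ elements P
  ∈-elements⁺ P {x} = ∈-filter⁺ (λ x → P x ≟ᴮ true) (∈-allFin x)

  ∈-elements⁻ : ∀ P {x} → x ∈ elements P → P x ≡ true
  ∈-elements⁻ P x∈ = proj₂ (∈-filter⁻ (λ x → P x ≟ᴮ true) {xs = allFin k} x∈)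

  elements-unique : ∀ P → Unique (elements P)
  elements-unique P = filter⁺ (λ x → P x ≟ᴮ true) (allFin⁺ k)

  count-split : ∀ (P Q : Fin k → Bool) → count (λ x → P x ∧ Q x) + count (λ x → P x ∧ not (Q x)) ≡ count P
  count-split P Q = go (allFin k)
    where
    go : ∀ xs → length (filter (λ x → (P x ∧ Q x) ≟ᴮ true) xs) + length (filter (λ x → (P x ∧ not (Q x)) ≟ᴮ true) xs)
              ≡ length (filter (λ x → P x ≟ᴮ true) xs)
    go []       = refl
    go (x ∷ xs) with P x | Q x
    ... | true  | true  = cong suc (go xs)
    ... | true  | false = trans (+-suc _ _) (cong suc (go xs))
    ... | false | _     = go xs

  count-mono : ∀ {P Q : Fin k → Bool} → (∀ x → P x ≡ true → Q x ≡ true) → count P ≤ count Q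
  count-mono {P} {Q} P⊆Q = go (allFin k)
    where
    go : ∀ xs → length (filter (λ x → P x ≟ᴮ true) xs) ≤ length (filter (λ x → Q x ≟ᴮ true) xs)
    go []       = z≤n
    go (x ∷ xs) with P x | Q x | P⊆Q x
    ... | true  | true  | _   = s≤s (go xs)
    ... | true  | false | imp = contradiction (imp refl) λ ()
    ... | false | true  | _   = m≤n⇒m≤1+n (go xs)
    ... | false | false | _   = go xs

  count-strict : ∀ {P Q : Fin k → Bool} {v} → (∀ x → P x ≡ true → Q x ≡ true) → P v ≡ false → Q v ≡ true → count P < count Q
  count-strict {P} {Q} {v} P⊆Q Pv Qv = begin-strict
    count P                                                  ≤⟨ count-mono (λ x Px → cong₂ _∧_ (P⊆Q x Px) Px) ⟩
    count (λ x → Q x ∧ P x)                                  <⟨ m<m+n _ (∈-length (∈-elements⁺ _ (cong₂ _∧_ Qv (cong not Pv)))) ⟩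
    count (λ x → Q x ∧ P x) + count (λ x → Q x ∧ not (P x))  ≡⟨ count-split Q P ⟩
    count Q                                                  ∎
    where open ≤-Reasoning

length-concatMap-≤ : ∀ {A B : Set} (g : A → List B) r xs → (∀ {x} → x ∈ xs → length (g x) ≤ r) →
                     length (concatMap g xs) ≤ length xs * r
length-concatMap-≤ g r []       _  = z≤n
length-concatMap-≤ g r (x ∷ xs) le = ≤-trans (≤-reflexive (length-++ (g x)))
  (+-mono-≤ (le (here refl)) (length-concatMap-≤ g r xs (le ∘ there)))

map-unique : ∀ {A B : Set} (g : A → B) {xs} → Unique xs →
             (∀ {x y} → x ∈ xs → y ∈ xs → x ≢ y → g x ≢ g y) → Unique (map g xs)
map-unique g []             _   = []
map-unique g {x ∷ xs} (x∉ ∷ xs!) inj =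
  All.tabulate (λ gy∈ → let y , y∈ , eq = ∈-map⁻ g gy∈ in
    subst (g x ≢_) (≡-sym eq) (inj (here refl) (there y∈) (All.lookup x∉ y∈)))
  ∷ map-unique g xs! (λ x∈ y∈ → inj (there x∈) (there y∈))

module Greedy {m n p″ c′ : ℕ} (𝒞 : Coding m n (suc (suc p″))) (𝒫 : Palette (suc (suc p″)) (suc c′))
              (decode-fl : ∀ a → Coding.decode 𝒞 (Palette.fl 𝒫 a) ≡ flipC (Coding.decode 𝒞 a))
              {N r : ℕ} (σ : Fin N → Fin N → Fin (suc (suc p″)))
              (σ-coherent : ∀ {i j} → i ≢ j → σ j i ≡ Palette.fl 𝒫 (σ i j))
              (extend : Extension.Extendable 𝒫 N σ (suc r)) where

  open Coding 𝒞
  open Palette 𝒫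

  private
    t c : ℕ
    t = suc r
    c = suc c′
    Vertex : Set
    Vertex = Fin N × Fin c

  -- The shifts of both ends act on the type. They commute with each other and with `fl`, so
  -- exchanging the ends only flips the connection.
  link : Vertex → Vertex → Conn m n
  link (i , x) (j , y) = if does (i ≟ j) then none else decode (act x (act y (σ i j)))

  link-≢ : ∀ {i x j y} → i ≢ j → link (i , x) (j , y) ≡ decode (act x (act y (σ i j)))
  link-≢ {i} {j = j} i≢j with i ≟ j
  ... | yes i≡j = contradiction i≡j i≢j
  ... | no  _   = refl

  link-≡ : ∀ i x y → link (i , x) (i , y) ≡ none
  link-≡ i x y with i ≟ i
  ... | yes _   = refl
  ... | no  i≢i = contradiction refl i≢i

  link-flip : ∀ z z′ → link z′ z ≡ flipC (link z z′)
  link-flip (i , x) (j , y) = go (i ≟ j)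
    where
    open ≡-Reasoning
    go : Dec (i ≡ j) → link (j , y) (i , x) ≡ flipC (link (i , x) (j , y))
    go (yes refl) = trans (link-≡ i y x) (cong flipC (≡-sym (link-≡ i x y)))
    go (no i≢j) = begin
      link (j , y) (i , x)                        ≡⟨ link-≢ (i≢j ∘ ≡-sym) ⟩
      decode (act y (act x (σ j i)))              ≡⟨ cong (decode ∘ act y ∘ act x) (σ-coherent i≢j) ⟩
      decode (act y (act x (fl (σ i j))))         ≡⟨ cong (decode ∘ act y) (act-fl x (σ i j)) ⟩
      decode (act y (fl (act x (σ i j))))         ≡⟨ cong decode (act-fl y (act x (σ i j))) ⟩
      decode (fl (act y (act x (σ i j))))         ≡⟨ decode-fl _ ⟩
      flipC (decode (act y (act x (σ i j))))      ≡⟨ cong (flipC ∘ decode) (act-comm y x (σ i j)) ⟩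
      flipC (decode (act x (act y (σ i j))))      ≡⟨ cong flipC (link-≢ i≢j) ⟨
      flipC (link (i , x) (j , y))                ∎

  target : MixedGraph m n (N * c)
  target .conn z z′      = link (remQuot c z) (remQuot c z′)
  target .conn-flip z z′ = link-flip (remQuot c z) (remQuot c z′)
  target .conn-loop z    = link-≡ _ _ _

  -- `zero` is a filler at `none`: requests go to adjacent vertices only, whose connection differs
  -- from `none` by `adj⇒conn`.
  code : Conn m n → Fin (suc (suc p″))
  code τ@none       = zero
  code τ@(arcOut _) = proj₁ (encode τ λ ())
  code τ@(arcIn _)  = proj₁ (encode τ λ ())
  code τ@(edge _)   = proj₁ (encode τ λ ())

  decode-code : ∀ τ → τ ≢ none → decode (code τ) ≡ τ
  decode-code none       τ≢none = contradiction refl τ≢none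
  decode-code (arcOut _) _ = proj₂ (encode _ λ ())
  decode-code (arcIn _)  _ = proj₂ (encode _ λ ())
  decode-code (edge _)   _ = proj₂ (encode _ λ ())

  module _ {k : ℕ} (G : SimpleGraph k) (G′ : MixedGraph m n k) (under : HasUnderlying G′ G)
           (Δ-bound : ∀ v → degree G v ≤ suc t) (degen : Degenerate G t) (z₀ : Vertex) where

    label : (Fin k → Vertex) → Fin k → Fin N
    label f = proj₁ ∘ f

    _⟵_ : (Fin k → Bool) → Fin k → Fin k → Bool
    (S ⟵ w) u = adj G u w ∧ S u

    -- apart keeps the demand of every vertex that is still to be coloured consistent.
    record Proper (S : Fin k → Bool) (f : Fin k → Vertex) : Set where
      field
        homo  : ∀ {u v} → S u ≡ true → S v ≡ true → adj G u v ≡ true → link (f u) (f v) ≡ conn G′ u v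
        apart : ∀ {w u u′} → S w ≡ false → (S ⟵ w) u ≡ true → (S ⟵ w) u′ ≡ true → u ≢ u′ → label f u ≢ label f u′

    -- A trace of the degeneracy order: a vertex outside `S` was removed when at most `t` of its
    -- neighbours remained, and the set has only shrunk since.
    Reserved : (Fin k → Bool) → Set
    Reserved S = ∀ {w} → S w ≡ false → count (S ⟵ w) ≤ t

    adj-≢ : ∀ {u v} → adj G u v ≡ true → u ≢ v
    adj-≢ {u} uv refl with trans (≡-sym uv) (irrefl G u)
    ... | ()

    adj-sym : ∀ {u v} → adj G u v ≡ true → adj G v u ≡ true
    adj-sym {u} {v} uv = trans (sym G v u) uv

    adj⇒conn : ∀ {u v} → adj G u v ≡ true → conn G′ u v ≢ none
    adj⇒conn {u} {v} uv eq with trans (≡-sym uv) (proj₁ (under u v) eq)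
    ... | ()

    module _ (S : Fin k → Bool) (v : Fin k) (Sv : S v ≡ true) where

      private
        S₀ = override S v false

      S₀-v : S₀ v ≡ false
      S₀-v = override-here S v false

      S₀-≢ : ∀ {u} → u ≢ v → S₀ u ≡ S u
      S₀-≢ = override-there S v false

      S₀⊆S : ∀ u → S₀ u ≡ true → S u ≡ true
      S₀⊆S u S₀u = go (u ≟ v)
        where
        go : Dec (u ≡ v) → S u ≡ true
        go (yes refl) = Sv
        go (no  u≢v)  = trans (≡-sym (S₀-≢ u≢v)) S₀u

      ⟵-⊆ : ∀ w u → (S₀ ⟵ w) u ≡ true → (S ⟵ w) u ≡ true
      ⟵-⊆ w u uw = let adj-uw , S₀u = ∧-true⁻ uw in cong₂ _∧_ adj-uw (S₀⊆S u S₀u)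

      module _ (few : count (S ⟵ v) ≤ t) (res : Reserved S) where

        reserved₀ : Reserved S₀
        reserved₀ {w} S₀w = ≤-trans (count-mono (⟵-⊆ w)) (go (w ≟ v))
          where
          go : Dec (w ≡ v) → count (S ⟵ w) ≤ t
          go (yes refl) = few
          go (no  w≢v)  = res (trans (≡-sym (S₀-≢ w≢v)) S₀w)

        -- The vertex `v` is the last one of `S` to be coloured. The `apart` of `S₀` gives its
        -- demand distinct keys; avoiding `forbidden` re-establishes `apart` for `S`.
        extend-proper : ∀ f → Proper S₀ f → ∃ (Proper S)
        extend-proper f prop = f′ , record { homo = homo′ _ _ (_ ≟ v) (_ ≟ v) ; apart = apart′ (_ ≟ v) (_ ≟ v) }
          where
          open Proper prop
          open Demands (suc (suc p″)) N using (Demand; keys)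

          back later : List (Fin k)
          back  = elements (S₀ ⟵ v)
          later = elements (λ w → adj G w v ∧ not (S₀ w))

          -- `link` will apply the shift of `f u` to the type; as that shift is an involution,
          -- applying it to the request beforehand cancels it.
          request : Fin k → Fin N × Fin (suc (suc p″))
          request u = label f u , act (proj₂ (f u)) (code (conn G′ v u))

          demand : Demand
          demand = map request back

          seen : Fin k → List (Fin N)
          seen w = map (label f) (elements (S₀ ⟵ w))

          forbidden : List (Fin N)
          forbidden = concatMap seen later

          keys-demand : keys demand ≡ map (label f) back
          keys-demand = go back
            where
            go : ∀ us → keys (map request us) ≡ map (label f) us
            go []       = refl
            go (_ ∷ us) = cong (_ ∷_) (go us)

          keys-unique : Unique (keys demand)
          keys-unique = subst Unique (≡-sym keys-demand) (map-unique (label f) (elements-unique (S₀ ⟵ v))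
            λ u∈ u′∈ → apart S₀-v (∈-elements⁻ (S₀ ⟵ v) u∈) (∈-elements⁻ (S₀ ⟵ v) u′∈))

          s : ℕ
          s = count (S₀ ⟵ v)

          s≤t : s ≤ t
          s≤t = reserved₀ S₀-v

          outside : ∀ {w} → w ∈ later → adj G w v ≡ true × S w ≡ false
          outside {w} w∈ with ∧-true⁻ (∈-elements⁻ (λ w → adj G w v ∧ not (S₀ w)) w∈)
          ... | wv , ¬S₀w = wv , trans (≡-sym (S₀-≢ (adj-≢ wv))) (go (S₀ w) ¬S₀w)
            where
            go : ∀ b → not b ≡ true → b ≡ false
            go false _ = refl

          -- At most `t` neighbours of `w` lie in `S`, and `v` is one of them. It has no label yet,
          -- so at most `r = t - 1` labels are seen.
          seen-few : ∀ {w} → w ∈ later → length (seen w) ≤ r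
          seen-few {w} w∈ with outside w∈
          ... | wv , Sw = ≤-trans (≤-reflexive (length-map (label f) (elements (S₀ ⟵ w))))
            (s≤s⁻¹ (≤-trans (count-strict (⟵-⊆ w) (trans (cong (adj G v w ∧_) S₀-v) (∧-zeroʳ (adj G v w)))
              (cong₂ _∧_ (adj-sym wv) Sv)) (res Sw)))

          -- The degree bound enters here: of at most `suc t` neighbours, `s` are already coloured.
          later-few : length later ≤ suc (t ∸ s)
          later-few = +-cancelˡ-≤ s (length later) (suc (t ∸ s)) (begin
            s + length later   ≡⟨ count-split (λ u → adj G u v) S₀ ⟩
            degree G v         ≤⟨ Δ-bound v ⟩
            suc t              ≡⟨ cong suc (m+[n∸m]≡n s≤t) ⟨
            suc (s + (t ∸ s))  ≡⟨ +-suc s (t ∸ s) ⟨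
            s + suc (t ∸ s)    ∎)
            where open ≤-Reasoning

          extension = extend (t ∸ s) demand forbidden keys-unique
            (trans (cong (_+ (t ∸ s)) (length-map request back)) (m+[n∸m]≡n s≤t))
            (≤-trans (length-concatMap-≤ seen r later seen-few) (*-monoˡ-≤ r later-few))
          i = proj₁ extension
          x = proj₁ (proj₂ extension)
          i-free = proj₁ (proj₂ (proj₂ extension))
          i-new = proj₁ (proj₂ (proj₂ (proj₂ extension)))
          fits = proj₂ (proj₂ (proj₂ (proj₂ extension)))

          f′ : Fin k → Vertex
          f′ = override f v (i , x)

          f′-v : f′ v ≡ (i , x)
          f′-v = override-here f v (i , x)

          f′-≢ : ∀ {u} → u ≢ v → f′ u ≡ f u
          f′-≢ = override-there f v (i , x)

          link-new : ∀ {u} → (S₀ ⟵ v) u ≡ true → link (i , x) (f u) ≡ conn G′ v u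
          link-new {u} uv = begin
            link (i , x) (f u)                    ≡⟨ link-≢ i≢ ⟩
            decode (act x (act y (σ i (label f u))))   ≡⟨ cong decode (act-comm x y _) ⟩
            decode (act y (act x (σ i (label f u))))   ≡⟨ cong (decode ∘ act y) (All.lookup fits (∈-map⁺ request u∈)) ⟩
            decode (act y (act y (code τ)))       ≡⟨ cong decode (act-inv y (code τ)) ⟩
            decode (code τ)                       ≡⟨ decode-code τ (adj⇒conn (adj-sym (proj₁ (∧-true⁻ uv)))) ⟩
            τ                                     ∎
            where
            open ≡-Reasoning
            y = proj₂ (f u)
            τ = conn G′ v u
            u∈ = ∈-elements⁺ (S₀ ⟵ v) uv
            i≢ : i ≢ label f u
            i≢ eq = i-new (subst (_∈ keys demand) (≡-sym eq) (∈-map⁺ proj₁ (∈-map⁺ request u∈)))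

          homo′ : ∀ u w → Dec (u ≡ v) → Dec (w ≡ v) → S u ≡ true → S w ≡ true → adj G u w ≡ true →
                  link (f′ u) (f′ w) ≡ conn G′ u w
          homo′ u w (yes refl) (yes refl) Su Sw uw = contradiction refl (adj-≢ uw)
          homo′ u w (yes refl) (no w≢v) Su Sw uw = trans (cong₂ link f′-v (f′-≢ w≢v))
            (link-new (cong₂ _∧_ (adj-sym uw) (trans (S₀-≢ w≢v) Sw)))
          homo′ u w (no u≢v) (yes refl) Su Sw uw = begin
            link (f′ u) (f′ w)         ≡⟨ cong₂ link (f′-≢ u≢v) f′-v ⟩
            link (f u) (i , x)         ≡⟨ link-flip (i , x) (f u) ⟩
            flipC (link (i , x) (f u)) ≡⟨ cong flipC (link-new (cong₂ _∧_ uw (trans (S₀-≢ u≢v) Su))) ⟩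
            flipC (conn G′ w u)        ≡⟨ conn-flip G′ w u ⟨
            conn G′ u w                ∎
            where open ≡-Reasoning
          homo′ u w (no u≢v) (no w≢v) Su Sw uw = trans (cong₂ link (f′-≢ u≢v) (f′-≢ w≢v))
            (homo (trans (S₀-≢ u≢v) Su) (trans (S₀-≢ w≢v) Sw) uw)

          i-unseen : ∀ {w u} → S w ≡ false → adj G v w ≡ true → (S ⟵ w) u ≡ true → u ≢ v → i ≢ label f u
          i-unseen {w} {u} Sw vw uw u≢v eq = i-free (∈-concatMap⁺ seen (Any.map (λ { refl → i∈seen }) w∈later))
            where
            w≢v = adj-≢ (adj-sym vw)
            w∈later : w ∈ later
            w∈later = ∈-elements⁺ (λ w → adj G w v ∧ not (S₀ w))
              (cong₂ _∧_ (adj-sym vw) (cong not (trans (S₀-≢ w≢v) Sw)))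
            i∈seen : i ∈ seen w
            i∈seen = subst (_∈ seen w) (≡-sym eq) (∈-map⁺ (label f) (∈-elements⁺ (S₀ ⟵ w)
              (cong₂ _∧_ (proj₁ (∧-true⁻ uw)) (trans (S₀-≢ u≢v) (proj₂ (∧-true⁻ uw))))))

          ⟵₀ : ∀ {w u} → u ≢ v → (S ⟵ w) u ≡ true → (S₀ ⟵ w) u ≡ true
          ⟵₀ u≢v uw = cong₂ _∧_ (proj₁ (∧-true⁻ uw)) (trans (S₀-≢ u≢v) (proj₂ (∧-true⁻ uw)))

          apart′ : ∀ {w u u′} → Dec (u ≡ v) → Dec (u′ ≡ v) → S w ≡ false → (S ⟵ w) u ≡ true → (S ⟵ w) u′ ≡ true →
                   u ≢ u′ → label f′ u ≢ label f′ u′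
          apart′ (yes refl) (yes refl) Sw uw u′w u≢u′ = contradiction refl u≢u′
          apart′ (yes refl) (no u′≢v) Sw uw u′w u≢u′ eq = i-unseen Sw (proj₁ (∧-true⁻ uw)) u′w u′≢v
            (trans (cong proj₁ (≡-sym f′-v)) (trans eq (cong proj₁ (f′-≢ u′≢v))))
          apart′ (no u≢v) (yes refl) Sw uw u′w u≢u′ eq = i-unseen Sw (proj₁ (∧-true⁻ u′w)) uw u≢v
            (trans (cong proj₁ (≡-sym f′-v)) (trans (≡-sym eq) (cong proj₁ (f′-≢ u≢v))))
          apart′ {w} (no u≢v) (no u′≢v) Sw uw u′w u≢u′ eq = apart (trans (S₀-≢ w≢v) Sw) (⟵₀ u≢v uw) (⟵₀ u′≢v u′w) u≢u′
            (trans (cong proj₁ (≡-sym (f′-≢ u≢v))) (trans eq (cong proj₁ (f′-≢ u′≢v))))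
            where
            w≢v : w ≢ v
            w≢v refl with trans (≡-sym Sv) Sw
            ... | ()

    colour : ∀ fuel S → count S ≤ fuel → Reserved S → ∃ (Proper S)
    colour fuel S size res with any? (λ v → S v ≟ᴮ true)
    ... | no empty = (λ _ → z₀) , record
      { homo  = λ {u} Su → contradiction (u , Su) empty
      ; apart = λ {w} {u} _ uw → contradiction (u , proj₂ (∧-true⁻ uw)) empty
      }
    colour zero       S size res | yes (v , Sv) = contradiction (≤-trans (count-strict {P = λ _ → false} {S} {v} (λ _ ()) refl Sv) size) λ ()
    colour (suc fuel) S size res | yes nonempty with degen induced nonempty
      where
      induced : Subgraph G
      induced .inS         = S
      induced .inF u w     = adj G u w ∧ (S u ∧ S w)
      induced .F-sym u w   = cong₂ _∧_ (sym G u w) (∧-comm (S u) (S w))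
      induced .F-sub u w F = let uw , SuSw = ∧-true⁻ F in uw , ∧-true⁻ SuSw
    ... | v , Sv , few = extend-proper S v Sv few′ res (proj₁ ih) (proj₂ ih)
      where
      few′ : count (S ⟵ v) ≤ t
      few′ = ≤-trans (count-mono {P = S ⟵ v} {λ u → adj G u v ∧ (S u ∧ S v)} λ u uv → let adj-uv , Su = ∧-true⁻ {adj G u v} uv in cong₂ _∧_ adj-uv (cong₂ _∧_ Su Sv)) few
      ih = colour fuel (override S v false)
        (s≤s⁻¹ (≤-trans (count-strict (S₀⊆S S v Sv) (S₀-v S v Sv) Sv) size)) (reserved₀ S v Sv few′ res)

    homomorphism : ∃ (IsColoredHom G′ target)
    homomorphism with colour (count everything) everything ≤-refl (λ ())
      where
      everything : Fin k → Bool
      everything _ = true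
    ... | f , prop = (λ u → combine (proj₁ (f u)) (proj₂ (f u))) , λ u v conn≢ →
      trans (cong₂ link (remQuot-combine (proj₁ (f u)) (proj₂ (f u))) (remQuot-combine (proj₁ (f v)) (proj₂ (f v))))
        (Proper.homo prop refl refl (conn⇒adj conn≢))
      where
      conn⇒adj : ∀ {u v} → conn G′ u v ≢ none → adj G u v ≡ true
      conn⇒adj {u} {v} conn≢ with adj G u v in eq
      ... | true  = refl
      ... | false = contradiction (proj₂ (under u v) eq) conn≢

-- Numerical estimates

open ≤-Reasoning

-- The union bound required by Extension.extendable, with weight ratio 8.
Sparse : ℕ → ℕ → ℕ → ℕ → ℕ → Set
Sparse p r N C w = (N * p) ^ suc r * w ^ N * C ^ suc r * 8 ^ r < suc r ! * (C ^ N * w ^ suc r)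

^-distribʳ-* : ∀ a b n → (a * b) ^ n ≡ a ^ n * b ^ n
^-distribʳ-* a b zero    = refl
^-distribʳ-* a b (suc n) = trans (cong (a * b *_) (^-distribʳ-* a b n)) (interchange a b (a ^ n) (b ^ n))
  where
  interchange : ∀ a b x y → a * b * (x * y) ≡ a * x * (b * y)
  interchange = solve 4 (λ a b x y → a :* b :* (x :* y) := a :* x :* (b :* y)) refl
    where open +-*-Solver

-- This is 1 - n x ≤ (1 - x)^n for x = b / (a + b), multiplied by (a + b)^(n+1).
bernoulli⁻ : ∀ a b n → (a + b) ^ n * (a + b) ≤ a ^ n * (a + b) + n * b * (a + b) ^ n
bernoulli⁻ a b zero    = ≤-reflexive (≡-sym (+-identityʳ _))
bernoulli⁻ a b (suc n) = begin
  (a + b) * y * (a + b)                        ≡⟨ split a b y ⟩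
  a * (y * (a + b)) + b * (y * (a + b))        ≤⟨ +-monoˡ-≤ (b * (y * (a + b))) (*-monoʳ-≤ a (bernoulli⁻ a b n)) ⟩
  a * (x * (a + b) + n * b * y) + b * (y * (a + b)) ≤⟨ m≤m+n _ (n * b * b * y) ⟩
  a * (x * (a + b) + n * b * y) + b * (y * (a + b)) + n * b * b * y ≡⟨ collect′ a b n x y ⟩
  a * x * (a + b) + suc n * b * ((a + b) * y)  ∎
  where
  x = a ^ n
  y = (a + b) ^ n
  split : ∀ a b y → (a + b) * y * (a + b) ≡ a * (y * (a + b)) + b * (y * (a + b))
  split = solve 3 (λ a b y → (a :+ b) :* y :* (a :+ b) := a :* (y :* (a :+ b)) :+ b :* (y :* (a :+ b))) refl
    where open +-*-Solver
  collect′ : ∀ a b n x y → a * (x * (a + b) + n * b * y) + b * (y * (a + b)) + n * b * b * y ≡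
                          a * x * (a + b) + suc n * b * ((a + b) * y)
  collect′ = solve 5 (λ a b n x y → a :* (x :* (a :+ b) :+ n :* b :* y) :+ b :* (y :* (a :+ b)) :+ n :* b :* b :* y :=
                          a :* x :* (a :+ b) :+ (con 1 :+ n) :* b :* ((a :+ b) :* y)) refl
    where open +-*-Solver

-- In `bernoulli⁻` the relative loss is at most t b / (w + b), which is at most one half.
halve-power : ∀ w b t .{{_ : NonZero (w + b)}} → 2 * (t * b) ≤ w + b → (w + b) ^ t ≤ 2 * w ^ t
halve-power w b t small = *-cancelʳ-≤ ((w + b) ^ t) (2 * w ^ t) (w + b) (+-cancelʳ-≤ (y * C) _ _ (begin
  y * C + y * C                       ≡⟨ cong (y * C +_) (+-identityʳ (y * C)) ⟨
  2 * (y * C)                         ≤⟨ *-monoʳ-≤ 2 (bernoulli⁻ w b t) ⟩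
  2 * (w ^ t * C + t * b * y)         ≡⟨ regroup (w ^ t) C (t * b) y ⟩
  2 * w ^ t * C + y * (2 * (t * b))   ≤⟨ +-monoʳ-≤ (2 * w ^ t * C) (*-monoʳ-≤ y small) ⟩
  2 * w ^ t * C + y * C               ∎))
  where
  C = w + b
  y = C ^ t
  regroup : ∀ x C s y → 2 * (x * C + s * y) ≡ 2 * x * C + y * (2 * s)
  regroup = solve 4 (λ x C s y → con 2 :* (x :* C :+ s :* y) := con 2 :* x :* C :+ y :* (con 2 :* s)) refl
    where open +-*-Solver

-- The ratio `(C / w) ^ t` caused by the keys is at most 2 and the gain `t !` is given away; what
-- remains is to compare `2 * (N * p) ^ t * 8 ^ r` with `(C / w) ^ N`.
sparse-criterion : ∀ p r N w b → 0 < w → 2 * (suc r * b) ≤ w + b →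
                   2 * (N * p) ^ suc r * 8 ^ r * w ^ N < (w + b) ^ N → Sparse p r N (w + b) w
sparse-criterion p r N w b w>0 small main = begin-strict
  q * w ^ N * C ^ t * 8 ^ r           ≤⟨ *-monoˡ-≤ (8 ^ r) (*-monoʳ-≤ (q * w ^ N) (halve-power w b t {{>-nonZero (≤-trans w>0 (m≤m+n w b))}} small)) ⟩
  q * w ^ N * (2 * w ^ t) * 8 ^ r     ≡⟨ regroup q (w ^ N) (w ^ t) (8 ^ r) ⟩
  2 * q * 8 ^ r * w ^ N * w ^ t       <⟨ *-monoˡ-< (w ^ t) {{m^n≢0 w t {{>-nonZero w>0}}}} main ⟩
  C ^ N * w ^ t                       ≤⟨ m≤n*m (C ^ N * w ^ t) (t !) {{t !≢0}} ⟩
  t ! * (C ^ N * w ^ t)               ∎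
  where
  t = suc r
  C = w + b
  q = (N * p) ^ t
  regroup : ∀ q x y z → q * x * (2 * y) * z ≡ 2 * q * z * x * y
  regroup = solve 4 (λ q x y z → q :* x :* (con 2 :* y) :* z := con 2 :* q :* z :* x :* y) refl
    where open +-*-Solver

t≤2^[t-2] : ∀ k → 4 + k ≤ 2 ^ (2 + k)
t≤2^[t-2] zero    = ≤-refl
t≤2^[t-2] (suc k) = ≤-trans (+-mono-≤ (m^n>0 2 (2 + k)) (t≤2^[t-2] k))
  (≤-reflexive (cong (2 ^ (2 + k) +_) (≡-sym (+-identityʳ _))))

p≤2^[p-1] : ∀ k → 3 + k ≤ 2 ^ (2 + k)
p≤2^[p-1] k = ≤-trans (n≤1+n (3 + k)) (t≤2^[t-2] k)

t²≤2^[t-2] : ∀ k → (k + 8) * (k + 8) ≤ 2 ^ (k + 6)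
t²≤2^[t-2] zero    = ≤-refl
t²≤2^[t-2] (suc k) = begin
  suc (k + 8) * suc (k + 8)                           ≤⟨ m≤m+n _ (k * k + 14 * k + 47) ⟩
  suc (k + 8) * suc (k + 8) + (k * k + 14 * k + 47)   ≡⟨ square k ⟩
  2 * ((k + 8) * (k + 8))                             ≤⟨ *-monoʳ-≤ 2 (t²≤2^[t-2] k) ⟩
  2 * 2 ^ (k + 6)                                     ∎
  where
  square : ∀ k → suc (k + 8) * suc (k + 8) + (k * k + 14 * k + 47) ≡ 2 * ((k + 8) * (k + 8))
  square = solve 1 (λ k → (con 1 :+ (k :+ con 8)) :* (con 1 :+ (k :+ con 8)) :+ (k :* k :+ con 14 :* k :+ con 47) :=
                          con 2 :* ((k :+ con 8) :* (k :+ con 8))) refl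
    where open +-*-Solver

4^[t+1]≤5^t : ∀ k → 4 ^ suc (k + 8) ≤ 5 ^ (k + 8)
4^[t+1]≤5^t zero    = ≤ᵇ⇒≤ (4 ^ 9) (5 ^ 8) tt
4^[t+1]≤5^t (suc k) = *-mono-≤ (≤ᵇ⇒≤ 4 5 tt) (4^[t+1]≤5^t k)

-- The union bound for p ≥ 3, with one vertex per label

module ManyTypes (t′ p′ : ℕ) where

  t p : ℕ
  t = 4 + t′
  p = 3 + p′

  5^t : ∀ k → 2 ^ (4 + k) * 2 ^ 5 ≤ 5 ^ (4 + k)
  5^t zero    = ≤ᵇ⇒≤ 512 625 tt
  5^t (suc k) = begin
    2 * 2 ^ (4 + k) * 2 ^ 5     ≡⟨ *-assoc 2 (2 ^ (4 + k)) (2 ^ 5) ⟩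
    2 * (2 ^ (4 + k) * 2 ^ 5)   ≤⟨ *-mono-≤ (≤ᵇ⇒≤ 2 5 tt) (5^t k) ⟩
    5 * 5 ^ (4 + k)             ∎

  -- A t-th power multiplies the exponent 5 + 2k by t ≥ 4, more than enough for the increase by 2.
  -- At k = p - 3, a further power t * t meets the bound of `exponent-bound`.
  5^t^ : ∀ k → 2 ^ (t ^ suc k) * 2 ^ (5 + 2 * k) ≤ 5 ^ (t ^ suc k)
  5^t^ zero    = subst (λ x → 2 ^ x * 2 ^ 5 ≤ 5 ^ x) (≡-sym (*-identityʳ t)) (5^t t′)
  5^t^ (suc k) = begin
    2 ^ (t * X) * 2 ^ (5 + 2 * suc k)      ≤⟨ *-monoʳ-≤ (2 ^ (t * X)) (^-monoʳ-≤ 2 grow) ⟩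
    2 ^ (t * X) * 2 ^ (e * t)              ≡⟨ cong₂ _*_ (trans (cong (2 ^_) (*-comm t X)) (≡-sym (^-*-assoc 2 X t))) (≡-sym (^-*-assoc 2 e t)) ⟩
    (2 ^ X) ^ t * (2 ^ e) ^ t              ≡⟨ ^-distribʳ-* (2 ^ X) (2 ^ e) t ⟨
    (2 ^ X * 2 ^ e) ^ t                    ≤⟨ ^-monoˡ-≤ t (5^t^ k) ⟩
    (5 ^ X) ^ t                            ≡⟨ trans (^-*-assoc 5 X t) (cong (5 ^_) (*-comm X t)) ⟩
    5 ^ (t * X)                            ∎
    where
    X = t ^ suc k
    e = 5 + 2 * k
    grow : 5 + 2 * suc k ≤ e * t
    grow = begin
      5 + 2 * suc k                                             ≤⟨ m≤m+n _ (13 + 6 * k + (5 + 2 * k) * t′) ⟩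
      5 + 2 * suc k + (13 + 6 * k + (5 + 2 * k) * t′)           ≡⟨ ring k t′ ⟩
      (5 + 2 * k) * (4 + t′)                                    ∎
      where
      ring : ∀ k t′ → 5 + 2 * suc k + (13 + 6 * k + (5 + 2 * k) * t′) ≡ (5 + 2 * k) * (4 + t′)
      ring = solve 2 (λ k t′ → con 5 :+ con 2 :* (con 1 :+ k) :+ (con 13 :+ con 6 :* k :+ (con 5 :+ con 2 :* k) :* t′) :=
                               (con 5 :+ con 2 :* k) :* (con 4 :+ t′)) refl
        where open +-*-Solver

  N C w : ℕ
  N = 2 * t ^ p * p ^ t
  C = 8 * p ^ t
  w = C ∸ 7

  p^t>0 : 0 < p ^ t
  p^t>0 = m^n>0 p t

  7<C : 7 < C
  7<C = *-monoʳ-≤ 8 p^t>0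

  w+7≡C : w + 7 ≡ C
  w+7≡C = m∸n+n≡m (<⇒≤ 7<C)

  -- The power of 2 obtained from t ≤ 2^(t-2) and p ≤ 2^(p-1): `2 + t′` is t - 2, `2 + p′` is p - 1,
  -- and `3 * (3 + t′)` comes from 8^(t-1).
  exponent : ℕ
  exponent = 1 + (1 + (2 + t′) * p + (2 + p′) * suc t) * t + 3 * (3 + t′)

  lhs-bound : 2 * (N * p) ^ t * 8 ^ (3 + t′) ≤ 2 ^ exponent
  lhs-bound = begin
    2 * (N * p) ^ t * 8 ^ (3 + t′)                                  ≤⟨ *-monoˡ-≤ (8 ^ (3 + t′)) (*-monoʳ-≤ 2 (^-monoˡ-≤ t Np)) ⟩
    2 * (2 ^ e) ^ t * 8 ^ (3 + t′)                                  ≡⟨ cong₂ (λ x y → 2 * x * y) (^-*-assoc 2 e t) (^-*-assoc 2 3 (3 + t′)) ⟩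
    2 ^ (1 + e * t) * 2 ^ (3 * (3 + t′))                            ≡⟨ ^-distribˡ-+-* 2 (1 + e * t) (3 * (3 + t′)) ⟨
    2 ^ exponent                                                    ∎
    where
    e = 1 + (2 + t′) * p + (2 + p′) * suc t
    Np : N * p ≤ 2 ^ e
    Np = begin
      2 * t ^ p * p ^ t * p                                 ≡⟨ trans (*-assoc (2 * t ^ p) (p ^ t) p) (cong (2 * t ^ p *_) (*-comm (p ^ t) p)) ⟩
      2 * t ^ p * p ^ suc t                                 ≤⟨ *-mono-≤ (*-monoʳ-≤ 2 (^-monoˡ-≤ p (t≤2^[t-2] t′))) (^-monoˡ-≤ (suc t) (p≤2^[p-1] p′)) ⟩
      2 * (2 ^ (2 + t′)) ^ p * (2 ^ (2 + p′)) ^ suc t       ≡⟨ cong₂ (λ x y → 2 * x * y) (^-*-assoc 2 (2 + t′) p) (^-*-assoc 2 (2 + p′) (suc t)) ⟩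
      2 ^ (1 + (2 + t′) * p) * 2 ^ ((2 + p′) * suc t)       ≡⟨ ^-distribˡ-+-* 2 (1 + (2 + t′) * p) _ ⟨
      2 ^ e                                                 ∎

  exponent-bound : exponent < (5 + 2 * p′) * (t * t)
  exponent-bound = begin-strict
    exponent                      <⟨ m<m+n exponent (s≤s (z≤n {1 + p′ * t})) ⟩
    exponent + (2 + p′ * t)       ≡⟨ ring t′ p′ ⟩
    (5 + 2 * p′) * (t * t)        ∎
    where
    ring : ∀ t′ p′ → 1 + (1 + (2 + t′) * (3 + p′) + (2 + p′) * (5 + t′)) * (4 + t′) + 3 * (3 + t′) + (2 + p′ * (4 + t′)) ≡
                     (5 + 2 * p′) * ((4 + t′) * (4 + t′))
    ring = solve 2 (λ t p → con 1 :+ (con 1 :+ (con 2 :+ t) :* (con 3 :+ p) :+ (con 2 :+ p) :* (con 5 :+ t)) :* (con 4 :+ t) :+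
                              con 3 :* (con 3 :+ t) :+ (con 2 :+ p :* (con 4 :+ t)) :=
                            (con 5 :+ con 2 :* p) :* ((con 4 :+ t) :* (con 4 :+ t))) refl
      where open +-*-Solver

  5^T-bound : 2 ^ exponent * 2 ^ (t ^ p) < 5 ^ (t ^ p)
  5^T-bound = begin-strict
    2 ^ exponent * 2 ^ (t ^ p)        <⟨ *-monoˡ-< (2 ^ (t ^ p)) {{m^n≢0 2 (t ^ p)}} (^-monoʳ-< 2 (≤ᵇ⇒≤ 2 2 tt) exponent-bound) ⟩
    2 ^ (e * (t * t)) * 2 ^ (t ^ p)   ≡⟨ cong₂ _*_ (≡-sym (^-*-assoc 2 e (t * t))) (trans (cong (2 ^_) T≡) (≡-sym (^-*-assoc 2 X (t * t)))) ⟩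
    (2 ^ e) ^ (t * t) * (2 ^ X) ^ (t * t) ≡⟨ trans (*-comm ((2 ^ e) ^ (t * t)) _) (≡-sym (^-distribʳ-* (2 ^ X) (2 ^ e) (t * t))) ⟩
    (2 ^ X * 2 ^ e) ^ (t * t)         ≤⟨ ^-monoˡ-≤ (t * t) (5^t^ p′) ⟩
    (5 ^ X) ^ (t * t)                 ≡⟨ trans (^-*-assoc 5 X (t * t)) (cong (5 ^_) (≡-sym T≡)) ⟩
    5 ^ (t ^ p)                       ∎
    where
    e = 5 + 2 * p′
    X = t ^ suc p′
    T≡ : t ^ p ≡ X * (t * t)
    T≡ = trans (≡-sym (*-assoc t t X)) (*-comm (t * t) X)

  -- `bernoulli` gives (C / w)^(2 p^t) ≥ 1 + 2 p^t * 7 / C = 11/4, which is rounded down to 5/2.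
  5w≤2C : 5 * w ^ (2 * p ^ t) ≤ 2 * C ^ (2 * p ^ t)
  5w≤2C = *-cancelˡ-≤ (4 * P) {{>-nonZero (≤-trans p^t>0 (m≤n*m P 4))}} (begin
    4 * P * (5 * x)                     ≤⟨ m≤m+n _ (2 * P * x) ⟩
    4 * P * (5 * x) + 2 * P * x         ≡⟨ ring₁ P x ⟩
    x * (8 * P) + 2 * P * 7 * x         ≡⟨ cong (λ z → x * z + 2 * P * 7 * x) w+7≡C ⟨
    x * (w + 7) + 2 * P * 7 * x         ≤⟨ bernoulli w 7 (2 * P) ⟩
    (w + 7) ^ (2 * P) * (w + 7)         ≡⟨ cong (λ z → z ^ (2 * P) * z) w+7≡C ⟩
    C ^ (2 * P) * (8 * P)               ≡⟨ ring₂ P (C ^ (2 * P)) ⟩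
    4 * P * (2 * C ^ (2 * P))           ∎)
    where
    P = p ^ t
    x = w ^ (2 * P)
    ring₁ : ∀ P x → 4 * P * (5 * x) + 2 * P * x ≡ x * (8 * P) + 2 * P * 7 * x
    ring₁ = solve 2 (λ P x → con 4 :* P :* (con 5 :* x) :+ con 2 :* P :* x := x :* (con 8 :* P) :+ con 2 :* P :* con 7 :* x) refl
      where open +-*-Solver
    ring₂ : ∀ P y → y * (8 * P) ≡ 4 * P * (2 * y)
    ring₂ = solve 2 (λ P y → y :* (con 8 :* P) := con 4 :* P :* (con 2 :* y)) refl
      where open +-*-Solver

  main : 2 * (N * p) ^ t * 8 ^ (3 + t′) * w ^ N < (w + 7) ^ N
  main = subst (λ z → 2 * (N * p) ^ t * 8 ^ (3 + t′) * w ^ N < z ^ N) (≡-sym w+7≡C)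
    (*-cancelʳ-< (2 ^ T) (2 * (N * p) ^ t * 8 ^ (3 + t′) * w ^ N) (C ^ N) (begin-strict
    2 * (N * p) ^ t * 8 ^ (3 + t′) * w ^ N * 2 ^ T  ≤⟨ *-monoˡ-≤ (2 ^ T) (*-monoˡ-≤ (w ^ N) lhs-bound) ⟩
    2 ^ exponent * w ^ N * 2 ^ T                    ≡⟨ x*y*z≡x*z*y (2 ^ exponent) (w ^ N) (2 ^ T) ⟩
    2 ^ exponent * 2 ^ T * w ^ N                    <⟨ *-monoˡ-< (w ^ N) {{m^n≢0 w N {{>-nonZero (m<n⇒0<n∸m 7<C)}}}} 5^T-bound ⟩
    5 ^ T * w ^ N                                   ≡⟨ cong (5 ^ T *_) (power w) ⟩
    5 ^ T * (w ^ (2 * p ^ t)) ^ T                   ≡⟨ ^-distribʳ-* 5 (w ^ (2 * p ^ t)) T ⟨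
    (5 * w ^ (2 * p ^ t)) ^ T                       ≤⟨ ^-monoˡ-≤ T 5w≤2C ⟩
    (2 * C ^ (2 * p ^ t)) ^ T                       ≡⟨ ^-distribʳ-* 2 (C ^ (2 * p ^ t)) T ⟩
    2 ^ T * (C ^ (2 * p ^ t)) ^ T                   ≡⟨ cong (2 ^ T *_) (power C) ⟨
    2 ^ T * C ^ N                                   ≡⟨ *-comm (2 ^ T) (C ^ N) ⟩
    C ^ N * 2 ^ T                                   ∎))
    where
    T = t ^ p
    power : ∀ x → x ^ N ≡ (x ^ (2 * p ^ t)) ^ T
    power x = trans (cong (x ^_) (x*y*z≡x*z*y 2 T (p ^ t))) (≡-sym (^-*-assoc x (2 * p ^ t) T))

  sparse : Sparse p (3 + t′) N C w
  sparse = subst (λ z → Sparse p (3 + t′) N z w) w+7≡C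
    (sparse-criterion p (3 + t′) N w 7 (m<n⇒0<n∸m 7<C) (≤-trans small (≤-reflexive (≡-sym w+7≡C))) main)
    where
    small : 2 * (t * 7) ≤ C
    small = begin
      2 * (t * 7)               ≤⟨ *-monoʳ-≤ 2 (*-monoˡ-≤ 7 (t≤2^[t-2] t′)) ⟩
      2 * (2 ^ (2 + t′) * 7)    ≤⟨ m≤m+n _ (18 * 2 ^ (2 + t′)) ⟩
      2 * (2 ^ (2 + t′) * 7) + 18 * 2 ^ (2 + t′) ≡⟨ ring (2 ^ (2 + t′)) ⟩
      8 * 2 ^ t                 ≤⟨ *-monoʳ-≤ 8 (^-monoˡ-≤ t (s≤s (s≤s (z≤n {1 + p′})))) ⟩
      8 * p ^ t                 ∎
      where
      ring : ∀ x → 2 * (x * 7) + 18 * x ≡ 8 * (2 * (2 * x))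
      ring = solve 1 (λ x → con 2 :* (x :* con 7) :+ con 18 :* x := con 8 :* (con 2 :* (con 2 :* x))) refl
        where open +-*-Solver

power-ratio : ∀ a b c x y n .{{_ : NonZero b}} → a * x ≤ b * y → b ^ n * c ≤ a ^ n → c * x ^ n ≤ y ^ n
power-ratio a b c x y n ax≤by bc≤a = *-cancelˡ-≤ (b ^ n) {{m^n≢0 b n}} (begin
  b ^ n * (c * x ^ n)   ≡⟨ *-assoc (b ^ n) c _ ⟨
  b ^ n * c * x ^ n     ≤⟨ *-monoˡ-≤ (x ^ n) bc≤a ⟩
  a ^ n * x ^ n         ≡⟨ ^-distribʳ-* a x n ⟨
  (a * x) ^ n           ≤⟨ ^-monoˡ-≤ n ax≤by ⟩
  (b * y) ^ n           ≡⟨ ^-distribʳ-* b y n ⟩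
  b ^ n * y ^ n         ∎)

-- The union bound for p = 2, with two vertices per label

module TwoTypes (t : ℕ) where

  N C w : ℕ
  N = t ^ 2 * 2 ^ t
  C = 8 * 2 ^ t
  -- The mean weight `C - l * c` for `l = 7` and `c = 2`.
  w = C ∸ 14

-- The exponents are kept opaque: 2 ^ (8 + k) would unfold into a sum of 256 terms.
module TwoTypesLarge (r k : ℕ) (r≡k+7 : r ≡ k + 7) where

  private
    t Q : ℕ
    t = suc r
    Q = 2 ^ k

  open TwoTypes t

  t≡k+8 : t ≡ k + 8
  t≡k+8 = trans (cong suc r≡k+7) (≡-sym (+-suc k 7))

  2^t≡ : 2 ^ t ≡ 256 * Q
  2^t≡ = trans (cong (2 ^_) t≡k+8) (trans (^-distribˡ-+-* 2 k 8) (*-comm Q 256))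

  C≡ : C ≡ 2048 * Q
  C≡ = trans (cong (8 *_) 2^t≡) (≡-sym (*-assoc 8 256 Q))

  14<C : 14 < C
  14<C = ≤-trans (≤ᵇ⇒≤ 15 2048 tt) (≤-trans (*-monoʳ-≤ 2048 (m^n>0 2 k)) (≤-reflexive (≡-sym C≡)))

  w>0 : 0 < w
  w>0 = m<n⇒0<n∸m 14<C

  w+14≡C : w + 14 ≡ C
  w+14≡C = m∸n+n≡m (<⇒≤ 14<C)

  -- `bernoulli` applied once to the exponent 2^t would give the ratio 11/4 only, whereas 5 is
  -- wanted. It is applied to 2^t / 16 = 16 Q instead, giving 1 + 16 * 14 / 2048 = 71/64, whose 16th
  -- power exceeds 5.
  71w≤64C : 71 * w ^ (16 * Q) ≤ 64 * C ^ (16 * Q)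
  71w≤64C = *-cancelˡ-≤ (32 * Q) {{>-nonZero (≤-trans (m^n>0 2 k) (m≤n*m Q 32))}} (begin
    32 * Q * (71 * x)                       ≡⟨ ring₁ Q x ⟩
    x * (2048 * Q) + 16 * Q * 14 * x        ≡⟨ cong (λ z → x * z + 16 * Q * 14 * x) (trans w+14≡C C≡) ⟨
    x * (w + 14) + 16 * Q * 14 * x          ≤⟨ bernoulli w 14 (16 * Q) ⟩
    (w + 14) ^ (16 * Q) * (w + 14)          ≡⟨ cong₂ (λ y z → y ^ (16 * Q) * z) w+14≡C (trans w+14≡C C≡) ⟩
    C ^ (16 * Q) * (2048 * Q)               ≡⟨ ring₂ Q (C ^ (16 * Q)) ⟩
    32 * Q * (64 * C ^ (16 * Q))            ∎)
    where
    x = w ^ (16 * Q)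
    ring₁ : ∀ Q x → 32 * Q * (71 * x) ≡ x * (2048 * Q) + 16 * Q * 14 * x
    ring₁ = solve 2 (λ Q x → con 32 :* Q :* (con 71 :* x) := x :* (con 2048 :* Q) :+ con 16 :* Q :* con 14 :* x) refl
      where open +-*-Solver
    ring₂ : ∀ Q y → y * (2048 * Q) ≡ 32 * Q * (64 * y)
    ring₂ = solve 2 (λ Q y → y :* (con 2048 :* Q) := con 32 :* Q :* (con 64 :* y)) refl
      where open +-*-Solver

  5w≤C : 5 * w ^ (2 ^ t) ≤ C ^ (2 ^ t)
  5w≤C = subst₂ (λ x y → 5 * x ≤ y) (≡-sym (power w)) (≡-sym (power C))
    (power-ratio 71 64 5 (w ^ (16 * Q)) (C ^ (16 * Q)) 16 71w≤64C (≤ᵇ⇒≤ (64 ^ 16 * 5) (71 ^ 16) tt))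
    where
    power : ∀ x → x ^ (2 ^ t) ≡ (x ^ (16 * Q)) ^ 16
    power x = trans (cong (x ^_) (trans 2^t≡ (ring Q))) (≡-sym (^-*-assoc x (16 * Q) 16))
      where
      ring : ∀ Q → 256 * Q ≡ 16 * Q * 16
      ring = solve 1 (λ Q → con 256 :* Q := con 16 :* Q :* con 16) refl
        where open +-*-Solver

  -- From t^2 ≤ 2^(t-2) the exponent of 2 on the left falls short of 2 t (t + 1) by exactly 2. The
  -- remaining power 4^(t (t+1)) is absorbed by 4^(t+1) ≤ 5^t.
  lhs-bound : 2 * (N * 2) ^ t * 8 ^ r < 5 ^ (t ^ 2)
  lhs-bound = begin-strict
    2 * (N * 2) ^ t * 8 ^ r           ≤⟨ *-monoˡ-≤ (8 ^ r) (*-monoʳ-≤ 2 (^-monoˡ-≤ t N2)) ⟩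
    2 * (2 ^ e) ^ t * 8 ^ r           ≡⟨ cong₂ (λ x y → 2 * x * y) (^-*-assoc 2 e t) (^-*-assoc 2 3 r) ⟩
    2 ^ (1 + e * t) * 2 ^ (3 * r)     ≡⟨ ^-distribˡ-+-* 2 (1 + e * t) (3 * r) ⟨
    2 ^ (1 + e * t + 3 * r)           <⟨ ^-monoʳ-< 2 (≤ᵇ⇒≤ 2 2 tt) exponent ⟩
    2 ^ (2 * (suc t * t))             ≡⟨ ^-*-assoc 2 2 (suc t * t) ⟨
    4 ^ (suc t * t)                   ≡⟨ ^-*-assoc 4 (suc t) t ⟨
    (4 ^ suc t) ^ t                   ≤⟨ ^-monoˡ-≤ t (subst (λ z → 4 ^ suc z ≤ 5 ^ z) (≡-sym t≡k+8) (4^[t+1]≤5^t k)) ⟩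
    (5 ^ t) ^ t                       ≡⟨ ^-*-assoc 5 t t ⟩
    5 ^ (t * t)                       ≡⟨ cong (λ z → 5 ^ (t * z)) (*-identityʳ t) ⟨
    5 ^ (t ^ 2)                       ∎
    where
    e = k + 6 + t + 1
    N2 : N * 2 ≤ 2 ^ e
    N2 = begin
      t ^ 2 * 2 ^ t * 2           ≤⟨ *-monoˡ-≤ 2 (*-monoˡ-≤ (2 ^ t) (≤-trans (≤-reflexive (cong (t *_) (*-identityʳ t)))
                                       (subst (λ z → z * z ≤ 2 ^ (k + 6)) (≡-sym t≡k+8) (t²≤2^[t-2] k)))) ⟩
      2 ^ (k + 6) * 2 ^ t * 2     ≡⟨ cong (_* 2) (^-distribˡ-+-* 2 (k + 6) t) ⟨
      2 ^ (k + 6 + t) * 2 ^ 1     ≡⟨ ^-distribˡ-+-* 2 (k + 6 + t) 1 ⟨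
      2 ^ e                       ∎
    ring : ∀ k → 1 + (k + 6 + (1 + (k + 7)) + 1) * (1 + (k + 7)) + 3 * (k + 7) + 2 ≡ 2 * ((2 + (k + 7)) * (1 + (k + 7)))
    ring = solve 1 (λ k → con 1 :+ (k :+ con 6 :+ (con 1 :+ (k :+ con 7)) :+ con 1) :* (con 1 :+ (k :+ con 7)) :+ con 3 :* (k :+ con 7) :+ con 2 :=
                          con 2 :* ((con 2 :+ (k :+ con 7)) :* (con 1 :+ (k :+ con 7)))) refl
      where open +-*-Solver
    exponent : 1 + e * t + 3 * r < 2 * (suc t * t)
    exponent = subst (λ r → 1 + (k + 6 + suc r + 1) * suc r + 3 * r < 2 * (suc (suc r) * suc r)) (≡-sym r≡k+7)
      (≤-trans (m<m+n _ {2} (s≤s z≤n)) (≤-reflexive (ring k)))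

  main : 2 * (N * 2) ^ t * 8 ^ r * w ^ N < (w + 14) ^ N
  main = subst (λ z → 2 * (N * 2) ^ t * 8 ^ r * w ^ N < z ^ N) (≡-sym w+14≡C) (begin-strict
    2 * (N * 2) ^ t * 8 ^ r * w ^ N   <⟨ *-monoˡ-< (w ^ N) {{m^n≢0 w N {{>-nonZero w>0}}}} lhs-bound ⟩
    5 ^ (t ^ 2) * w ^ N                     ≡⟨ cong (5 ^ (t ^ 2) *_) (power w) ⟩
    5 ^ (t ^ 2) * (w ^ (2 ^ t)) ^ (t ^ 2)   ≡⟨ ^-distribʳ-* 5 (w ^ (2 ^ t)) (t ^ 2) ⟨
    (5 * w ^ (2 ^ t)) ^ (t ^ 2)             ≤⟨ ^-monoˡ-≤ (t ^ 2) 5w≤C ⟩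
    (C ^ (2 ^ t)) ^ (t ^ 2)                 ≡⟨ power C ⟨
    C ^ N                                   ∎)
    where
    power : ∀ x → x ^ N ≡ (x ^ (2 ^ t)) ^ (t ^ 2)
    power x = trans (cong (x ^_) (*-comm (t ^ 2) (2 ^ t))) (≡-sym (^-*-assoc x (2 ^ t) (t ^ 2)))

  sparse : Sparse 2 r N C w
  sparse = subst (λ z → Sparse 2 r N z w) w+14≡C
    (sparse-criterion 2 r N w 14 w>0 (≤-trans small (≤-reflexive (≡-sym w+14≡C))) main)
    where
    small : 2 * (t * 14) ≤ C
    small = begin
      2 * (t * 14)              ≡⟨ *-comm 2 (t * 14) ⟩
      t * 14 * 2                ≡⟨ *-assoc t 14 2 ⟩
      t * 28                    ≤⟨ *-monoʳ-≤ t (≤-trans (≤ᵇ⇒≤ 28 64 tt) (*-monoʳ-≤ 8 8≤t)) ⟩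
      t * (8 * t)               ≡⟨ x*[y*z]≡y*[x*z] t 8 t ⟩
      8 * (t * t)               ≤⟨ *-monoʳ-≤ 8 (subst (λ z → z * z ≤ 2 ^ z) (≡-sym t≡k+8)
                                     (≤-trans (t²≤2^[t-2] k) (^-monoʳ-≤ 2 (+-monoʳ-≤ k (≤ᵇ⇒≤ 6 8 tt))))) ⟩
      8 * 2 ^ t                 ∎
      where
      8≤t : 8 ≤ t
      8≤t = subst (8 ≤_) (≡-sym t≡k+8) (m≤n+m 8 k)

-- For t from 4 to 7 the estimate t^2 ≤ 2^(t-2) fails and the inequality is evaluated. At t = 4 it
-- depends on the factor `t !` that `sparse-criterion` gives away.
sparse₂ : ∀ t′ → let open TwoTypes (4 + t′) in w + 14 ≡ C × Sparse 2 (3 + t′) N C w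
sparse₂ 0 = refl , <ᵇ⇒< _ _ tt
sparse₂ 1 = refl , <ᵇ⇒< _ _ tt
sparse₂ 2 = refl , <ᵇ⇒< _ _ tt
sparse₂ 3 = refl , <ᵇ⇒< _ _ tt
sparse₂ (suc (suc (suc (suc k)))) = TwoTypesLarge.w+14≡C (7 + k) k (+-comm 7 k) , TwoTypesLarge.sparse (7 + k) k (+-comm 7 k)

-- Palettes and assembly of the bound

trivialPalette : ∀ {p} (fl : Fin p → Fin p) → (∀ a → fl (fl a) ≡ a) → Palette p 1
trivialPalette fl fl-inv = record
  { fl = fl ; act = λ _ a → a ; fl-inv = fl-inv
  ; act-inv = λ _ _ → refl ; act-comm = λ _ _ _ → refl ; act-fl = λ _ _ → refl
  ; act-free = λ { {zero} {zero} _ _ → refl }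
  }

-- The union bound with one vertex per label is too weak for p = 2, Δ = 5; two vertices per
-- label, exchanged by the swap of the two types, halve the number of labels.
swapPalette : (fl : Fin 2 → Fin 2) → (∀ a → fl (fl a) ≡ a) → Palette 2 2
swapPalette fl fl-inv = record
  { fl = fl ; act = act ; fl-inv = fl-inv
  ; act-inv = act-inv ; act-comm = act-comm ; act-fl = act-fl ; act-free = act-free
  }
  where
  act : Fin 2 → Fin 2 → Fin 2
  act zero       a = a
  act (suc zero) a = opposite a
  act-inv : ∀ x a → act x (act x a) ≡ a
  act-inv zero       a = refl
  act-inv (suc zero) a = opposite-involutive a
  act-comm : ∀ x y a → act x (act y a) ≡ act y (act x a)
  act-comm zero       y          a = refl
  act-comm (suc zero) zero       a = refl
  act-comm (suc zero) (suc zero) a = refl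
  ≢⇒opposite : ∀ {a b : Fin 2} → a ≢ b → a ≡ opposite b
  ≢⇒opposite {zero}     {zero}     a≢b = contradiction refl a≢b
  ≢⇒opposite {zero}     {suc zero} _   = refl
  ≢⇒opposite {suc zero} {zero}     _   = refl
  ≢⇒opposite {suc zero} {suc zero} a≢b = contradiction refl a≢b
  opposite-≢ : ∀ (a : Fin 2) → opposite a ≢ a
  opposite-≢ zero       ()
  opposite-≢ (suc zero) ()
  act-fl : ∀ x a → act x (fl a) ≡ fl (act x a)
  act-fl zero       a = refl
  -- An involution is injective, so it sends `a` and `opposite a` to different elements; among two
  -- elements, different means opposite.
  act-fl (suc zero) a = ≡-sym (≢⇒opposite λ eq →
    opposite-≢ a (trans (≡-sym (fl-inv (opposite a))) (trans (cong fl eq) (fl-inv a))))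
  act-free : ∀ {x y} a → act x a ≡ act y a → x ≡ y
  act-free {zero}     {zero}     a _  = refl
  act-free {zero}     {suc zero} a eq = contradiction (≡-sym eq) (opposite-≢ a)
  act-free {suc zero} {zero}     a eq = contradiction eq (opposite-≢ a)
  act-free {suc zero} {suc zero} a _  = refl

[t+1][t-1]<t² : ∀ r → suc (suc r) * r < suc r ^ 2
[t+1][t-1]<t² r = ≤-reflexive (square r)
  where
  square : ∀ r → suc (suc (suc r) * r) ≡ suc r ^ 2
  square = solve 1 (λ r → con 1 :+ (con 2 :+ r) :* r := (con 1 :+ r) :^ 2) refl
    where open +-*-Solver

module _ {m n k r : ℕ} (G : SimpleGraph k) (G′ : MixedGraph m n k) (under : HasUnderlying G′ G)
         (Δ-bound : ∀ v → degree G v ≤ suc (suc r)) (degen : Degenerate G (suc r)) where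

  private
    t : ℕ
    t = suc r

  chi-bound : ∀ {p″ c′} (let p = suc (suc p″)) (𝒞 : Coding m n p) (𝒫 : Palette p (suc c′)) →
              (∀ a → Coding.decode 𝒞 (Palette.fl 𝒫 a) ≡ flipC (Coding.decode 𝒞 a)) → ∀ N w →
              w + 7 * suc c′ ≡ 8 * p ^ t → Sparse p r N (8 * p ^ t) w → suc t * r < N → ChiAtMost G′ (N * suc c′)
  chi-bound 𝒞 𝒫 decode-fl N w w+ sparse N> with Extension.extendable 𝒫 N 7 r w w+ sparse N>
  ... | σ , coherent , extend = N * _ , ≤-refl , target , homomorphism G G′ under Δ-bound degen (fromℕ< N> , zero)
    where open Greedy 𝒞 𝒫 decode-fl σ coherent extend

chi-≤ : ∀ {m n k} t′ p → 2 ≤ p → Coding m n p → let t = 4 + t′ in (G : SimpleGraph k) (G′ : MixedGraph m n k) →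
        HasUnderlying G′ G → (∀ v → degree G v ≤ suc t) → Degenerate G t → ChiAtMost G′ (2 * t ^ p * p ^ t)
chi-≤ t′ 1 (s≤s ()) 𝒞 G G′ under Δ-bound degen
chi-≤ t′ 2 _ 𝒞 G G′ under Δ-bound degen = subst (ChiAtMost G′) regroup
  (chi-bound G G′ under Δ-bound degen 𝒞 (swapPalette flip flip-involutive) decode-flip N w (proj₁ (sparse₂ t′)) (proj₂ (sparse₂ t′))
    (≤-trans ([t+1][t-1]<t² (3 + t′)) (m≤m*n (t ^ 2) (2 ^ t) {{m^n≢0 2 t}})))
  where
  t = 4 + t′
  open Coding 𝒞
  open TwoTypes t
  regroup : t ^ 2 * 2 ^ t * 2 ≡ 2 * t ^ 2 * 2 ^ t
  regroup = trans (*-comm (t ^ 2 * 2 ^ t) 2) (≡-sym (*-assoc 2 (t ^ 2) (2 ^ t)))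
chi-≤ t′ (suc (suc (suc p′))) _ 𝒞 G G′ under Δ-bound degen = subst (ChiAtMost G′) (*-identityʳ N)
  (chi-bound G G′ under Δ-bound degen 𝒞 (trivialPalette flip flip-involutive) decode-flip N w w+7≡C sparse
    (≤-trans ([t+1][t-1]<t² (3 + t′)) (≤-trans (^-monoʳ-≤ t (s≤s (s≤s (z≤n {suc p′}))))
      (≤-trans (m≤n*m (t ^ p) 2) (m≤m*n (2 * t ^ p) (p ^ t) {{m^n≢0 p t}})))))
  where
  open Coding 𝒞
  open ManyTypes t′ p′

theorem6 : (m n Δ : ℕ) → 2 * m + n ≥ 2 → Δ ≥ 5 →
    (k : ℕ) (G : SimpleGraph k) → MaxDegree G Δ → Degeneracy G (Δ ∸ 1) →
    (G' : MixedGraph m n k) → HasUnderlying G' G →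
    ChiAtMost G' (2 * (Δ ∸ 1) ^ (2 * m + n) * (2 * m + n) ^ (Δ ∸ 1))
theorem6 m n .(5 + t′) p≥2 (s≤s (s≤s (s≤s (s≤s (s≤s {n = t′} _))))) k G (Δ-bound , _) (degen , _) G' under =
  chi-≤ t′ (2 * m + n) p≥2 (coding m n) G G' under Δ-bound degen
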